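{- Let $n\ge 3$ and let $G$ and $H$ be graphs on $n$ vertices that have at least $\frac{2n}{3}+1$ common cards. Then $G$ and $H$ have the same girth. (Equivalently: the girth of a graph on $n$ vertices can be determined from any $\frac{2n}{3}+1$ of its cards.)
   Context: All graphs are finite and simple. The girth of a graph is the length of its shortest cycle, and is $\infty$ if the graph has no cycle. For a graph $X$ and a vertex $v$, the card $X-v$ is the unlabeled graph obtained by deleting $v$ and its incident edges; the deck of $X$ is the multiset $\{X-v : v\in V(X)\}$. The number of common cards of two graphs $X,Y$ on the same number of vertices is the size of the multiset intersection of their decks, i.e. the largest $m$ such that there are distinct vertices $x_1,\dots,x_m$ of $X$ and distinct vertices $y_1,\dots,y_m$ of $Y$ with $X-x_i\cong Y-y_i$ for all $i$. -}

module Defs where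

open import Data.Nat using (ℕ; zero; suc; _≤_)
open import Data.Fin using (Fin; zero; suc; punchIn; inject₁; fromℕ)
open import Data.Bool using (Bool; true; false)
open import Data.Maybe using (Maybe; just; nothing)
open import Data.Product using (Σ; _×_; ∃-syntax)
open import Data.Empty using (⊥)
open import Relation.Nullary using (¬_)
open import Relation.Binary.PropositionalEquality using (_≡_)
open import Function.Bundles using (Bijection; _⤖_; _⇔_)
open import Function.Definitions using (Injective)

record Graph (n : ℕ) : Set where
  field
    adj    : Fin n → Fin n → Bool
    sym    : ∀ i j → adj i j ≡ adj j i
    irrefl : ∀ i → adj i i ≡ false
open Graph public

_≅_ : {m : ℕ} → Graph m → Graph m → Set
_≅_ {m} X Y = Σ (Fin m ⤖ Fin m) λ f →
  ∀ i j → adj Y (Bijection.to f i) (Bijection.to f j) ≡ adj X i j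

card : {n : ℕ} → Graph (suc n) → Fin (suc n) → Graph n
card X v = record
  { adj    = λ i j → adj X (punchIn v i) (punchIn v j)
  ; sym    = λ i j → sym X (punchIn v i) (punchIn v j)
  ; irrefl = λ i → irrefl X (punchIn v i)
  }

HasCommonCards : {n : ℕ} → Graph (suc n) → Graph (suc n) → ℕ → Set
HasCommonCards {n} X Y m =
  Σ (Fin m → Fin (suc n)) λ x → Σ (Fin m → Fin (suc n)) λ y →
    Injective _≡_ _≡_ x × Injective _≡_ _≡_ y ×
    (∀ i → card X (x i) ≅ card Y (y i))

IsCycle : {n : ℕ} → Graph n → (k : ℕ) → (Fin (suc k) → Fin n) → Set
IsCycle X k c =
  Injective _≡_ _≡_ c ×
  (∀ (i : Fin k) → adj X (c (inject₁ i)) (c (suc i)) ≡ true) ×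
  adj X (c (fromℕ k)) (c zero) ≡ true

HasCycle : {n : ℕ} → Graph n → ℕ → Set
HasCycle X zero    = ⊥
HasCycle X (suc k) = (3 ≤ suc k) × ∃[ c ] IsCycle X k c

-- Girth values: just ℓ for a finite girth ℓ, nothing for ∞.
ℕ∞ : Set
ℕ∞ = Maybe ℕ

IsGirth : {n : ℕ} → Graph n → ℕ∞ → Set
IsGirth X (just ℓ) = HasCycle X ℓ × (∀ k → HasCycle X k → ℓ ≤ k)
IsGirth X nothing  = ∀ k → ¬ HasCycle X k

SameGirth : {n : ℕ} → Graph n → Graph n → Set
SameGirth X Y = ∀ (g : ℕ∞) → IsGirth X g ⇔ IsGirth Y g

{-# OPTIONS --safe #-}

-- Suppose G has girth g, attained by a cycle C, H has no cycle of length at most g, and G − x i ≅ H − y i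
-- for m indices i. Every x i lies on C, as otherwise H would contain a copy of C; so m ≤ g, and the κ = n − g vertices off C
-- satisfy 2κ + 3 ≤ m. A cycle missing κ + 1 vertices would be too short, which forces G to have
-- no cycle other than C; in particular G − x i is a forest.
--
-- If H has a cycle, it is longer than C and passes through all y i, so each forest G − x i contains a
-- path on g vertices. Such a path gains enough vertices off C, at one of its ends, to single out
-- x i among the vertices of C up to a choice of direction. Hence m ≤ 2κ, a contradiction.
--
-- If H is a forest, let W be the component of C in G. For those x i with no neighbour off C (all but
-- at most κ), the image of W − x i is a component of H − y i, and comparing the sizes of these
-- components shows that it contains every other such y j. The part of H behind y i, seen from this
-- component, then contains a leaf, and different i yield different leaves. On the other hand H − y i ≅ G − x i
-- has few leaves. Together these leave only the case m = n = 3, κ = 0 with all vertices of H of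
-- degree at most one, which is excluded directly.
module Submission where

open import Defs
open import Data.Nat using (ℕ; zero; suc; _≤_; _<_; _+_; _*_; _∸_; z≤n; s≤s; s≤s⁻¹; z<s)
import Data.Nat.Properties as ℕ
open import Data.Nat.Properties hiding (_≟_; suc-injective)
open import Data.Nat.Induction using (<-rec)
open import Data.Nat.Solver using (module +-*-Solver)
open import Data.Fin using (Fin; zero; suc; toℕ; fromℕ; inject₁; inject≤; lower₁; punchOut; splitAt; join)
open import Data.Fin.Properties using (_≟_; all?; any?; inject₁-lower₁; inject≤-injective; injective⇒≤; join-splitAt; lower₁-injective; punchIn-punchOut; splitAt-join; suc-injective; toℕ-fromℕ; toℕ-injective; toℕ-lower₁; toℕ<n)
open import Data.Fin.Permutation using (Permutation; _⟨$⟩ʳ_; _⟨$⟩ˡ_; flip; insert; insert-punchIn; inverseʳ; inverseˡ)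
open import Data.Bool using (true)
import Data.Bool.Properties as Bool
open import Data.Maybe using (just; nothing)
open import Data.List using (List; []; _∷_; _++_; _ʳ++_; length; lookup; map; take)
open import Data.List.Properties using (++-assoc; ++-ʳ++; length-++; length-map; length-take; length-ʳ++; ∷-injectiveˡ)
open import Data.List.Membership.Propositional using (_∈_; _∉_)
open import Data.List.Membership.Propositional.Properties using (∈-lookup)
open import Data.List.Relation.Unary.All as All using (All; []; _∷_)
import Data.List.Relation.Unary.All.Properties as All
open import Data.List.Relation.Unary.AllPairs using ([]; _∷_)
open import Data.List.Relation.Unary.Any using (here; there)
open import Data.List.Relation.Unary.Unique.Propositional using (Unique)
open import Data.Product using (Σ; ∃; ∃-syntax; _×_; _,_; proj₁; proj₂)
open import Data.Sum using (_⊎_; inj₁; inj₂; [_,_])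
open import Data.Empty using (⊥)
open import Data.Unit using (⊤; tt)
open import Data.Vec as Vec using (Vec; []; _∷_)
open import Data.Vec.Properties using (lookup∘tabulate)
open import Function using (_∘_)
open import Function.Bundles using (mk⇔)
open import Function.Definitions using (Injective)
open import Function.Properties.Bijection using (⤖⇒↔)
open import Relation.Binary.Definitions using (tri<; tri≈; tri>)
open import Relation.Binary.PropositionalEquality using (_≡_; _≢_; refl; cong; cong₂; subst; trans; ≢-sym)
  renaming (sym to ≡-sym)
open import Relation.Nullary using (¬_; Dec; yes; no; contradiction)
open import Relation.Nullary.Decidable using (¬?; map′; _×-dec_; _→-dec_)
open import Relation.Unary using (Decidable)

private variable
  A B : Set
  m n o : ℕ

-- Counting by injections on finite sets.

Inj : (A → B) → Set
Inj f = Injective _≡_ _≡_ f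

infixr 5 _◂_

_◂_ : A → (Fin n → A) → Fin (suc n) → A
(x ◂ f) zero    = x
(x ◂ f) (suc i) = f i

◂-injective : {x : A} {f : Fin n → A} → Inj f → (∀ i → f i ≢ x) → Inj (x ◂ f)
◂-injective f-inj x∉f {zero}  {zero}  _  = refl
◂-injective f-inj x∉f {zero}  {suc j} eq = contradiction (≡-sym eq) (x∉f j)
◂-injective f-inj x∉f {suc i} {zero}  eq = contradiction eq (x∉f i)
◂-injective f-inj x∉f {suc i} {suc j} eq = cong suc (f-inj eq)

splitAt-injective : ∀ m {o} → Inj (splitAt m {o})
splitAt-injective m {o} {i} {j} eq =
  trans (≡-sym (join-splitAt m o i)) (trans (cong (join m o) eq) (join-splitAt m o j))

join-injective : ∀ m o → Inj (join m o)
join-injective m o {i} {j} eq =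
  trans (≡-sym (splitAt-join m o i)) (trans (cong (splitAt m) eq) (splitAt-join m o j))

disjoint-injections : {f : Fin m → Fin n} {h : Fin o → Fin n} →
  Inj f → Inj h → (∀ i j → f i ≢ h j) → m + o ≤ n
disjoint-injections {m} {n} {o} {f} {h} f-inj h-inj disj =
  injective⇒≤ (λ eq → splitAt-injective m (copair (splitAt m _) (splitAt m _) eq))
  where
  copair : ∀ s t → [ f , h ] s ≡ [ f , h ] t → s ≡ t
  copair (inj₁ i) (inj₁ j) eq = cong inj₁ (f-inj eq)
  copair (inj₁ i) (inj₂ j) eq = contradiction eq (disj i j)
  copair (inj₂ i) (inj₁ j) eq = contradiction (≡-sym eq) (disj j i)
  copair (inj₂ i) (inj₂ j) eq = cong inj₂ (h-inj eq)

joint-cover : {f : Fin m → Fin n} {h : Fin o → Fin n} →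
  (∀ v → (∃[ i ] f i ≡ v) ⊎ (∃[ j ] h j ≡ v)) → n ≤ m + o
joint-cover {m} {n} {o} {f} {h} cover =
  injective⇒≤ {f = λ v → join m o (index (cover v))}
    (λ {u} {v} eq → index-injective (cover u) (cover v) (join-injective m o eq))
  where
  index : ∀ {v} → (∃[ i ] f i ≡ v) ⊎ (∃[ j ] h j ≡ v) → Fin m ⊎ Fin o
  index (inj₁ (i , _)) = inj₁ i
  index (inj₂ (j , _)) = inj₂ j

  index-injective : ∀ {u v} (s : (∃[ i ] f i ≡ u) ⊎ (∃[ j ] h j ≡ u)) (t : (∃[ i ] f i ≡ v) ⊎ (∃[ j ] h j ≡ v)) →
    index s ≡ index t → u ≡ v
  index-injective (inj₁ (i , p)) (inj₁ (_ , q)) refl = trans (≡-sym p) q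
  index-injective (inj₂ (i , p)) (inj₂ (_ , q)) refl = trans (≡-sym p) q

record Enumeration {n} (P : Fin n → Set) : Set where
  field
    size      : ℕ
    element   : Fin size → Fin n
    injective : Inj element
    sound     : ∀ i → P (element i)
    complete  : ∀ v → P v → ∃[ i ] element i ≡ v

enumerate : {P : Fin n → Set} → Decidable P → Enumeration P
enumerate {zero} P? = record
  { size = 0 ; element = λ () ; injective = λ {} ; sound = λ () ; complete = λ () }
enumerate {suc n} {P} P? with enumerate (P? ∘ suc) | P? zero
... | E | yes p₀ = record
  { size      = suc size
  ; element   = zero ◂ (suc ∘ element)
  ; injective = ◂-injective (injective ∘ suc-injective) (λ _ ())
  ; sound     = λ { zero → p₀ ; (suc i) → sound i }
  ; complete  = λ { zero _ → zero , refl
                  ; (suc v) p → let (i , eq) = complete v p in suc i , cong suc eq }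
  } where open Enumeration E
... | E | no ¬p₀ = record
  { size      = size
  ; element   = suc ∘ element
  ; injective = injective ∘ suc-injective
  ; sound     = sound
  ; complete  = λ { zero p → contradiction p ¬p₀
                  ; (suc v) p → let (i , eq) = complete v p in i , cong suc eq }
  } where open Enumeration E

-- Putting `x` in front of the images of an enumeration of `P` would give one more element of `P`
-- than the enumeration has.
no-proper-self-injection : {P : Fin n → Set} → Decidable P → (f : Fin n → Fin n) → Inj f →
  (∀ v → P v → P (f v)) → ∀ x → P x → (∀ v → P v → f v ≢ x) → ⊥
no-proper-self-injection {P = P} P? f f-inj f-P x px miss = <-irrefl refl
  (injective⇒≤ {f = λ i → proj₁ (index i)}
    (λ {i} {j} eq → ◂-injective (λ e → injective (f-inj e)) (λ k → miss _ (sound k))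
      (trans (≡-sym (proj₂ (index i))) (trans (cong element eq) (proj₂ (index j))))))
  where
  open Enumeration (enumerate P?)
  index : ∀ i → ∃[ k ] element k ≡ (x ◂ (f ∘ element)) i
  index zero    = complete x px
  index (suc i) = complete _ (f-P _ (sound i))

-- In the forest case the component of C has to be decidable. The goal there is `⊥`, so decidability
-- under a double negation suffices.
¬¬-decidable : (P : Fin n → Set) → ¬ ¬ (Decidable P)
¬¬-decidable {zero}  P k = k λ ()
¬¬-decidable {suc n} P k =
  ¬¬-decidable (P ∘ suc) λ P? →
  (λ (k₀ : ¬ Dec (P zero)) → k₀ (no (k₀ ∘ yes))) λ p₀ →
  k λ { zero → p₀ ; (suc v) → P? v }

-- Reduced walks and acyclicity.

Adj : Graph n → Fin n → Fin n → Set
Adj X u v = adj X u v ≡ true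

Adj-sym : (X : Graph n) {u v : Fin n} → Adj X u v → Adj X v u
Adj-sym X {u} {v} = trans (sym X v u)

Adj-irrefl : (X : Graph n) {u v : Fin n} → Adj X u v → u ≢ v
Adj-irrefl X {u} uv refl with trans (≡-sym uv) (irrefl X u)
... | ()

module _ {A : Set} where

  data HeadNot (x : A) : List A → Set where
    []  : HeadNot x []
    [_] : ∀ {y ys} → x ≢ y → HeadNot x (y ∷ ys)

  HeadsDiffer : List A → List A → Set
  HeadsDiffer []      ys = ⊤
  HeadsDiffer (x ∷ _) ys = HeadNot x ys

  end : A → List A → A
  end x []       = x
  end x (y ∷ ys) = end y ys

  end-∈ : ∀ x y ys → end x (y ∷ ys) ∈ y ∷ ys
  end-∈ x y []       = here refl
  end-∈ x y (z ∷ ys) = there (end-∈ y z ys)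

  end-All : ∀ {P : A → Set} x ys → All P (x ∷ ys) → P (end x ys)
  end-All x []       (p ∷ _)  = p
  end-All x (y ∷ ys) (_ ∷ ps) = end-All y ys ps

  end-++ : ∀ x ys {zs} → end x (ys ++ zs) ≡ end (end x ys) zs
  end-++ x []       = refl
  end-++ x (y ∷ ys) = end-++ y ys

  All-ʳ++ : ∀ {P : A → Set} {xs ys} → All P xs → All P ys → All P (xs ʳ++ ys)
  All-ʳ++ []       qs = qs
  All-ʳ++ (p ∷ ps) qs = All-ʳ++ ps (p ∷ qs)

  Unique-ʳ++ʳ : ∀ xs {ys : List A} → Unique (xs ʳ++ ys) → Unique ys
  Unique-ʳ++ʳ []       u = u
  Unique-ʳ++ʳ (x ∷ xs) u with Unique-ʳ++ʳ xs u
  ... | _ ∷ u′ = u′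

  Unique-ʳ++-disjoint : ∀ xs {ys} {v : A} → Unique (xs ʳ++ ys) → v ∈ xs → v ∉ ys
  Unique-ʳ++-disjoint (x ∷ xs) u (here refl) v∈ys with Unique-ʳ++ʳ xs u
  ... | v≢ ∷ _ = All.lookup v≢ v∈ys refl
  Unique-ʳ++-disjoint (x ∷ xs) u (there v∈xs) v∈ys = Unique-ʳ++-disjoint xs u v∈xs (there v∈ys)

  Unique-lookup-injective : ∀ {xs : List A} → Unique xs → Inj (lookup xs)
  Unique-lookup-injective (_ ∷ _)   {zero}  {zero}  _  = refl
  Unique-lookup-injective (x≢ ∷ _)  {zero}  {suc j} eq = contradiction eq (All.lookup x≢ (∈-lookup j))
  Unique-lookup-injective (x≢ ∷ _)  {suc i} {zero}  eq = contradiction (≡-sym eq) (All.lookup x≢ (∈-lookup i))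
  Unique-lookup-injective (_ ∷ u)   {suc i} {suc j} eq = cong suc (Unique-lookup-injective u eq)

-- A reduced (non-backtracking) walk, as its list of vertices.
data Reduced (X : Graph n) : List (Fin n) → Set where
  []   : Reduced X []
  [-]  : ∀ {x} → Reduced X (x ∷ [])
  step : ∀ {x y ys} → Adj X x y → HeadNot x ys → Reduced X (y ∷ ys) → Reduced X (x ∷ y ∷ ys)

module _ (X : Graph n) where

  private V = Fin n

  tail-reduced : ∀ {x xs} → Reduced X (x ∷ xs) → Reduced X xs
  tail-reduced [-]          = []
  tail-reduced (step _ _ r) = r

  -- The result runs back along `p` to `a` and then out along `q`, so only the turn at `a` could
  -- backtrack. When the induction moves the turn to `b`, reducedness of `a ∷ b ∷ p` supplies the
  -- condition there.
  reduced-ʳ++ : ∀ {a} p {q} → Reduced X (a ∷ p) → Reduced X (a ∷ q) → HeadsDiffer p q → Reduced X (p ʳ++ a ∷ q)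
  reduced-ʳ++     []      _                 rq _    = rq
  reduced-ʳ++ {a} (b ∷ p) (step ab a≢ rp) rq diff =
    reduced-ʳ++ p rp (step (Adj-sym X ab) diff rq) (differ p a≢)
    where
    differ : ∀ p {q} → HeadNot a p → HeadsDiffer p (a ∷ q)
    differ []      _     = tt
    differ (c ∷ p) [ a≢c ] = [ ≢-sym a≢c ]

  reduced-++ : ∀ a r {p} → Reduced X (a ∷ r) → Reduced X (end a r ∷ p) →
    All (λ v → HeadNot v p) (a ∷ r) → Reduced X (a ∷ r ++ p)
  reduced-++ a []          _                rp _         = rp
  reduced-++ a (b ∷ [])    (step ab _ _)  rp (a≢ ∷ _)  = step ab a≢ rp
  reduced-++ a (b ∷ c ∷ r) (step ab [ a≢c ] rr) rp (_ ∷ ≢s) = step ab [ a≢c ] (reduced-++ b (c ∷ r) rr rp ≢s)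

  reduced-take : ∀ j c p → Reduced X (c ∷ p) → Reduced X (c ∷ take j p)
  reduced-take zero          c p           r             = [-]
  reduced-take (suc j)       c []          r             = [-]
  reduced-take (suc zero)    c (x ∷ p)     (step cx _ r) = step cx [] [-]
  reduced-take (suc (suc j)) c (x ∷ [])    r             = r
  reduced-take (suc (suc j)) c (x ∷ y ∷ p) (step cx [ c≢y ] r) = step cx [ c≢y ] (reduced-take (suc j) x (y ∷ p) r)

  reduced-suffix : ∀ xs {ys} → Reduced X (xs ++ ys) → Reduced X ys
  reduced-suffix []       r = r
  reduced-suffix (x ∷ xs) r = reduced-suffix xs (tail-reduced r)

  reduced-prefix : ∀ xs {ys} → Reduced X (xs ++ ys) → Reduced X xs
  reduced-prefix []           r = []
  reduced-prefix (x ∷ [])     r = [-]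
  reduced-prefix (x ∷ y ∷ []) (step xy _ r) = step xy [] [-]
  reduced-prefix (x ∷ y ∷ z ∷ xs) (step xy [ x≢z ] r) = step xy [ x≢z ] (reduced-prefix (y ∷ z ∷ xs) r)

  CycleIn : (V → Set) → Set
  CycleIn S = ∃[ k ] (3 ≤ suc k) × Σ (Fin (suc k) → V) λ c → IsCycle X k c × (∀ i → S (c i))

  private
    lookup-adj : ∀ {x xs} → Reduced X (x ∷ xs) → ∀ (i : Fin (length xs)) →
      Adj X (lookup (x ∷ xs) (inject₁ i)) (lookup (x ∷ xs) (suc i))
    lookup-adj (step xy _ r) zero    = xy
    lookup-adj (step xy _ r) (suc i) = lookup-adj r i

    lookup-last : ∀ x (xs : List V) → lookup (x ∷ xs) (fromℕ (length xs)) ≡ end x xs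
    lookup-last x []       = refl
    lookup-last x (y ∷ xs) = lookup-last y xs

    -- the part of x ∷ xs before the first return to x
    first-return : ∀ {x z} zs → Reduced X (z ∷ zs) → All (x ≢_) (z ∷ zs) ⊎
      ((x ≡ z) ⊎ (∃[ ys ] ∃[ ws ] (z ∷ zs ≡ z ∷ ys ++ x ∷ ws) × Reduced X (z ∷ ys) × Adj X (end z ys) x × All (x ≢_) (z ∷ ys)))
    first-return {x} {z} zs r with x ≟ z
    ... | yes x≡z = inj₂ (inj₁ x≡z)
    first-return {x} {z} []       r | no x≢z = inj₁ (x≢z ∷ [])
    first-return {x} {z} (y ∷ zs) (step zy z≢ r) | no x≢z with first-return {x} zs r
    ... | inj₁ x≢ = inj₁ (x≢z ∷ x≢)
    ... | inj₂ (inj₁ refl) = inj₂ (inj₂ ([] , zs , refl , [-] , zy , x≢z ∷ []))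
    ... | inj₂ (inj₂ ([] , ws , eq , r′ , ad , x≢)) = inj₂ (inj₂ (y ∷ [] , ws , cong (z ∷_) eq , step zy [] r′ , ad , x≢z ∷ x≢))
    ... | inj₂ (inj₂ (w ∷ ys , ws , refl , r′ , ad , x≢)) with z≢
    ...   | [ z≢w ] = inj₂ (inj₂ (y ∷ w ∷ ys , ws , refl , step zy [ z≢w ] r′ , ad , x≢z ∷ x≢))

  unique-prefix : ∀ xs {ys : List V} → Unique (xs ++ ys) → Unique xs
  unique-prefix []       u        = []
  unique-prefix (x ∷ xs) (x≢ ∷ u) = All.++⁻ˡ xs x≢ ∷ unique-prefix xs u

  -- Once the tail has no repetition, only a return to `x` can be one. The part before the first
  -- return closes up to a cycle, with at least three vertices because adjacency is irreflexive and
  -- the walk does not backtrack.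
  unique-or-cycle : ∀ {S} xs → Reduced X xs → All S xs → Unique xs ⊎ CycleIn S
  unique-or-cycle []       _ _ = inj₁ []
  unique-or-cycle (x ∷ []) _ _ = inj₁ ([] ∷ [])
  unique-or-cycle {S} (x ∷ z ∷ zs) r@(step xz x≢ r′) (sx ∷ sxs) with unique-or-cycle (z ∷ zs) r′ sxs
  ... | inj₂ cyc = inj₂ cyc
  ... | inj₁ u with first-return {x} zs r′
  ...   | inj₁ x∉ = inj₁ (x∉ ∷ u)
  ...   | inj₂ (inj₁ x≡z) = contradiction x≡z (Adj-irrefl X xz)
  ...   | inj₂ (inj₂ ([] , ws , refl , _ , _ , _)) with x≢
  ...     | [ x≢x ] = contradiction refl x≢x
  unique-or-cycle {S} (x ∷ z ∷ zs) (step xz x≢ r′) (sx ∷ sxs) | inj₁ u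
        | inj₂ (inj₂ (y ∷ ys , ws , refl , rys , ad , x∉)) with x≢
  ...     | [ x≢y ] = inj₂
    ( length (z ∷ y ∷ ys) , s≤s (s≤s (s≤s z≤n)) , lookup (x ∷ z ∷ y ∷ ys)
    , ( Unique-lookup-injective (x∉ ∷ unique-prefix (z ∷ y ∷ ys) u)
      , lookup-adj (step xz [ x≢y ] rys)
      , trans (cong (λ v → adj X v x) (lookup-last y ys)) ad)
    , λ i → All.lookup (sx ∷ All.++⁻ˡ (z ∷ y ∷ ys) sxs) (∈-lookup {xs = x ∷ z ∷ y ∷ ys} i))

  -- Absence of cycles in `S` is expressed through walks, the form in which it yields uniqueness of
  -- paths.
  Acyclic : (V → Set) → Set
  Acyclic S = ∀ xs → Reduced X xs → All S xs → Unique xs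

  acyclic : ∀ {S} → ¬ CycleIn S → Acyclic S
  acyclic no-cycle xs r s with unique-or-cycle xs r s
  ... | inj₁ u = u
  ... | inj₂ c = contradiction c no-cycle

  -- Where the walks first part, going back along one and out along the other is a reduced walk that
  -- visits the common end twice. If one walk stops first, the other revisits a vertex.
  reduced-unique : ∀ {S} → Acyclic S → ∀ a p q → Reduced X (a ∷ p) → Reduced X (a ∷ q) →
    All S (a ∷ p) → All S (a ∷ q) → end a p ≡ end a q → p ≡ q
  reduced-unique ac a []      []      rp rq sp sq eq = refl
  reduced-unique ac a []      (c ∷ q) rp rq sp sq eq with ac _ rq sq
  ... | a≢ ∷ _ = contradiction eq (All.lookup a≢ (end-∈ a c q))
  reduced-unique ac a (b ∷ p) []      rp rq sp sq eq with ac _ rp sp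
  ... | a≢ ∷ _ = contradiction (≡-sym eq) (All.lookup a≢ (end-∈ a b p))
  reduced-unique ac a (b ∷ p) (c ∷ q) rp rq (sa ∷ sp) sq eq with b ≟ c
  ... | yes refl = cong (b ∷_) (reduced-unique ac b p q (tail-reduced rp) (tail-reduced rq) sp (All.tail sq) eq)
  ... | no b≢c = contradiction (there (subst (_∈ c ∷ q) (≡-sym eq) (end-∈ a c q)))
    (Unique-ʳ++-disjoint (b ∷ p) (ac _ (reduced-ʳ++ (b ∷ p) rp rq [ b≢c ]) (All-ʳ++ sp sq)) (end-∈ a b p))

reduced-reverse : ∀ {n} (X : Graph n) xs → Reduced X xs → Reduced X (xs ʳ++ [])
reduced-reverse X []           r = []
reduced-reverse X (x ∷ [])     r = [-]
reduced-reverse X (x ∷ y ∷ xs) r = reduced-ʳ++ X (y ∷ xs) r [-] []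

reduced-from-end : ∀ {n} (X : Graph n) v M {B} → Reduced X (v ∷ M ++ B) → Reduced X (end v M ∷ B)
reduced-from-end X v []      r = r
reduced-from-end X v (w ∷ M) r = reduced-from-end X w M (tail-reduced X r)

-- Cycles as periodic sequences.

module _ {A : Set} where

  run : (ℕ → A) → ℕ → List A
  run z zero    = []
  run z (suc L) = z 1 ∷ run (z ∘ suc) L

  runDown : (ℕ → A) → ℕ → List A
  runDown z zero    = []
  runDown z (suc L) = z L ∷ runDown z L

  end-run : ∀ z L → end (z 0) (run z L) ≡ z L
  end-run z zero    = refl
  end-run z (suc L) = end-run (z ∘ suc) L

  end-runDown : ∀ z L → end (z L) (runDown z L) ≡ z 0
  end-runDown z zero    = refl
  end-runDown z (suc L) = end-runDown z L

  length-run : ∀ z L → length (run z L) ≡ L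
  length-run z zero    = refl
  length-run z (suc L) = cong suc (length-run (z ∘ suc) L)

  length-runDown : ∀ z L → length (runDown z L) ≡ L
  length-runDown z zero    = refl
  length-runDown z (suc L) = cong suc (length-runDown z L)

  All-run : ∀ {P : A → Set} z L → (∀ s → s ≤ L → P (z s)) → All P (z 0 ∷ run z L)
  All-run z zero    p = p 0 z≤n ∷ []
  All-run z (suc L) p = p 0 z≤n ∷ All-run (z ∘ suc) L (λ s s≤L → p (suc s) (s≤s s≤L))

  All-runDown : ∀ {P : A → Set} z L → (∀ s → s ≤ L → P (z s)) → All P (z L ∷ runDown z L)
  All-runDown z zero    p = p 0 z≤n ∷ []
  All-runDown z (suc L) p = p (suc L) ≤-refl ∷ All-runDown z L (λ s s≤L → p s (m≤n⇒m≤1+n s≤L))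

module _ (X : Graph n) {z : ℕ → Fin n} (adjacent : ∀ t → Adj X (z t) (z (suc t)))
         (no-return : ∀ t → z t ≢ z (2 + t)) where

  reduced-runDown : ∀ L → Reduced X (z L ∷ runDown z L)
  reduced-runDown zero    = [-]
  reduced-runDown (suc zero) = step (Adj-sym X (adjacent 0)) [] [-]
  reduced-runDown (suc (suc L)) = step (Adj-sym X (adjacent (suc L))) [ ≢-sym (no-return L) ] (reduced-runDown (suc L))

reduced-run : (X : Graph n) {z : ℕ → Fin n} → (∀ t → Adj X (z t) (z (suc t))) →
  (∀ t → z t ≢ z (2 + t)) → ∀ L → Reduced X (z 0 ∷ run z L)
reduced-run X adjacent no-return zero          = [-]
reduced-run X adjacent no-return (suc zero)    = step (adjacent 0) [] [-]
reduced-run X adjacent no-return (suc (suc L)) =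
  step (adjacent 0) [ no-return 0 ] (reduced-run X (adjacent ∘ suc) (no-return ∘ suc) (suc L))

cyclicSuc : Fin (suc m) → Fin (suc m)
cyclicSuc {m} i with m ℕ.≟ toℕ i
... | yes _  = zero
... | no m≢i = suc (lower₁ i m≢i)

cyclicSuc-injective : Inj (cyclicSuc {m})
cyclicSuc-injective {m} {i} {j} eq with m ℕ.≟ toℕ i | m ℕ.≟ toℕ j
... | yes p | yes q = toℕ-injective (trans (≡-sym p) q)
cyclicSuc-injective {m} {i} {j} () | yes p | no _
cyclicSuc-injective {m} {i} {j} () | no _ | yes q
... | no p | no q = lower₁-injective (suc-injective eq)

-- This is reduction modulo `suc m`, defined by iterating the successor so that consecutive times
-- are consecutive on the cycle by definition.
residue : ℕ → Fin (suc m)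
residue zero    = zero
residue (suc t) = cyclicSuc (residue t)

toℕ-residue : ∀ t → t ≤ m → toℕ (residue {m} t) ≡ t
toℕ-residue zero    _ = refl
toℕ-residue {m} (suc t) t<m with m ℕ.≟ toℕ (residue {m} t)
... | yes eq = contradiction (trans eq (toℕ-residue t (<⇒≤ t<m))) (≢-sym (<⇒≢ t<m))
... | no neq = cong suc (trans (toℕ-lower₁ _ neq) (toℕ-residue t (<⇒≤ t<m)))

residue-toℕ : (i : Fin (suc m)) → residue (toℕ i) ≡ i
residue-toℕ i = toℕ-injective (toℕ-residue (toℕ i) (s≤s⁻¹ (toℕ<n i)))

residue-period : ∀ t → residue {m} (t + suc m) ≡ residue t
residue-period {m} zero with m ℕ.≟ toℕ (residue {m} m)
... | yes _  = refl
... | no neq = contradiction (≡-sym (toℕ-residue m ≤-refl)) neq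
residue-period (suc t) = cong cyclicSuc (residue-period t)

residue-+ : ∀ j {s t} → residue {m} s ≡ residue t → residue {m} (j + s) ≡ residue (j + t)
residue-+ zero    eq = eq
residue-+ (suc j) eq = cong cyclicSuc (residue-+ j eq)

residue-cancel : ∀ j {s t} → residue {m} (j + s) ≡ residue (j + t) → residue {m} s ≡ residue t
residue-cancel zero    eq = eq
residue-cancel (suc j) eq = residue-cancel j (cyclicSuc-injective eq)

-- Cancelling `s + i` leaves the times `0` and `t ∸ s`. The latter is positive and at most `m`,
-- hence its own residue.
residue-distinct : ∀ {s t} i → s < t → t ≤ m + s → residue {m} (s + i) ≢ residue (t + i)
residue-distinct {m} {s} {t} i s<t t≤ eq with residue {m} 0 ≟ residue (t ∸ s)
... | no neq = neq (residue-cancel {m} (s + i) (trans (cong residue (+-identityʳ (s + i)))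
        (trans eq (cong residue (trans (cong (_+ i) (≡-sym (m+[n∸m]≡n (<⇒≤ s<t)))) (swap s (t ∸ s)))))))
  where
  swap : ∀ s d → s + d + i ≡ s + i + d
  swap s d = trans (+-assoc s d i) (trans (cong (s +_) (+-comm d i)) (≡-sym (+-assoc s i d)))
... | yes e with trans (cong toℕ e) (toℕ-residue (t ∸ s) (m≤n+o⇒m∸n≤o t s (subst (t ≤_) (+-comm m s) t≤)))
...   | 0≡ = <⇒≢ (m<n⇒0<n∸m s<t) 0≡

module Around (X : Graph n) {k} (3≤ : 3 ≤ suc k) {c : Fin (suc k) → Fin n} (cyc : IsCycle X k c) where

  -- Unrolling the cycle over all natural numbers turns arcs through index zero into ordinary
  -- segments.
  around : ℕ → Fin n
  around t = c (residue t)

  around-toℕ : ∀ i → around (toℕ i) ≡ c i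
  around-toℕ i = cong c (residue-toℕ i)

  around-period : ∀ t → around (t + suc k) ≡ around t
  around-period t = cong c (residue-period t)

  around-+ : ∀ j {s t} → around s ≡ around t → around (j + s) ≡ around (j + t)
  around-+ j eq = cong c (residue-+ j (proj₁ cyc eq))

  around-cancel : ∀ j {s t} → around (j + s) ≡ around (j + t) → around s ≡ around t
  around-cancel j eq = cong c (residue-cancel j (proj₁ cyc eq))

  around-distinct : ∀ {s t} i → s < t → t ≤ k + s → around (s + i) ≢ around (t + i)
  around-distinct i s<t t≤ eq = residue-distinct i s<t t≤ (proj₁ cyc eq)

  around-injective : ∀ i {s t} → s ≤ k → t ≤ k → around (s + i) ≡ around (t + i) → s ≡ t
  around-injective i {s} {t} s≤ t≤ eq with <-cmp s t
  ... | tri< s<t _ _ = contradiction eq (around-distinct i s<t (≤-trans t≤ (m≤m+n k s)))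
  ... | tri≈ _ s≡t _ = s≡t
  ... | tri> _ _ t<s = contradiction (≡-sym eq) (around-distinct i t<s (≤-trans s≤ (m≤m+n k t)))

  around-adj : ∀ t → Adj X (around t) (around (suc t))
  around-adj t = c-adj (residue t)
    where
    c-adj : ∀ i → Adj X (c i) (c (cyclicSuc i))
    c-adj i with k ℕ.≟ toℕ i
    ... | yes k≡i = subst (λ j → Adj X (c j) (c zero))
                      (toℕ-injective (trans (toℕ-fromℕ k) k≡i)) (proj₂ (proj₂ cyc))
    ... | no k≢i  = subst (λ j → Adj X (c j) (c (suc (lower₁ i k≢i)))) (inject₁-lower₁ i k≢i)
                      (proj₁ (proj₂ cyc) (lower₁ i k≢i))

  around-no-return : ∀ t → around t ≢ around (2 + t)
  around-no-return t = around-distinct t z<s (≤-trans (s≤s⁻¹ 3≤) (m≤m+n k 0))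

  reduced-around : ∀ i L → Reduced X (around i ∷ run (λ t → around (t + i)) L)
  reduced-around i = reduced-run X (λ t → around-adj (t + i)) (λ t → around-no-return (t + i))

  reduced-aroundDown : ∀ i L → Reduced X (around (L + i) ∷ runDown (λ t → around (t + i)) L)
  reduced-aroundDown i = reduced-runDown X (λ t → around-adj (t + i)) (λ t → around-no-return (t + i))

-- A shortest cycle C and the κ vertices off it.

module Cycle {n} (G : Graph n) {k} (3≤g : 3 ≤ suc k) {c : Fin (suc k) → Fin n} (cyc : IsCycle G k c) where

  open Around G 3≤g cyc public

  V = Fin n
  g = suc k

  OnC Off : V → Set
  OnC v = ∃[ i ] c i ≡ v
  Off v = ¬ OnC v

  OnC? : Decidable OnC
  OnC? v = any? (λ i → c i ≟ v)

  around-OnC : ∀ t → OnC (around t)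
  around-OnC t = residue t , refl

  OnC-around : ∀ {v} → OnC v → ∃[ t ] t ≤ k × around t ≡ v
  OnC-around (i , refl) = toℕ i , s≤s⁻¹ (toℕ<n i) , around-toℕ i

  module Outside = Enumeration (enumerate (¬? ∘ OnC?))

  κ = Outside.size

  off-index : ∀ {v} → Off v → ∃[ i ] Outside.element i ≡ v
  off-index = Outside.complete _

  g+κ≤n : g + κ ≤ n
  g+κ≤n = disjoint-injections (proj₁ cyc) Outside.injective (λ i j eq → Outside.sound j (i , eq))

  n≤g+κ : n ≤ g + κ
  n≤g+κ = joint-cover cover
    where
    cover : ∀ v → (∃[ i ] c i ≡ v) ⊎ (∃[ j ] Outside.element j ≡ v)
    cover v with OnC? v
    ... | yes on = inj₁ on
    ... | no off = inj₂ (off-index off)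

  module Shortest (shortest : ∀ l → HasCycle G l → g ≤ l) (gap : 3 + (κ + κ) ≤ g) where

    -- Avoiding κ + 1 vertices leaves fewer than `g` vertices for the cycle.
    cycle-meets : ∀ {l} → 3 ≤ suc l → {z : Fin (suc l) → V} → IsCycle G l z →
      {f : Fin (suc κ) → V} → Inj f → ¬ (∀ i j → z i ≢ f j)
    cycle-meets {l} 3≤ z-cyc f-inj disj = <⇒≱ (+-cancelʳ-≤ κ (2 + l) g (≤-trans
        (≤-reflexive (≡-sym (+-suc (suc l) κ)))
        (≤-trans (disjoint-injections (proj₁ z-cyc) f-inj disj) n≤g+κ)))
      (shortest (suc l) (3≤ , _ , z-cyc))

    acyclic-missing : ∀ {S : V → Set} {f : Fin (suc κ) → V} → Inj f → (∀ j → ¬ S (f j)) → Acyclic G S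
    acyclic-missing {S} f-inj ¬S = acyclic G λ (l , 3≤ , z , z-cyc , zS) →
      cycle-meets 3≤ z-cyc f-inj (λ i j eq → ¬S j (subst S eq (zS i)))

    -- There are κ + 1 `missed` vertices, so that by `acyclic-missing` the arc is the only reduced
    -- walk between its ends that avoids them.
    record Arc (u v : V) : Set where
      field
        path      : List V
        reduced   : Reduced G (u ∷ path)
        ends      : end u path ≡ v
        onC       : All OnC (u ∷ path)
        missed    : Fin (suc κ) → V
        missed-injective : Inj missed
        missed-onC       : ∀ t → OnC (missed t)
        misses           : All (λ x → ∀ t → missed t ≢ x) (u ∷ path)

    -- By `small`, the `L + 1` vertices of the arc and κ + 1 further vertices fit on C together.
    module _ (i L : ℕ) (small : L + (2 + κ) ≤ g) where

      private
        bound : ∀ (t : Fin (suc κ)) → suc (L + toℕ t) ≤ k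
        bound t = s≤s⁻¹ (≤-trans (s≤s (s≤s (+-monoʳ-≤ L (s≤s⁻¹ (toℕ<n t)))))
          (≤-trans (≤-reflexive (≡-sym (trans (+-suc L (suc κ)) (cong suc (+-suc L κ))))) small))

        beyond : Fin (suc κ) → V
        beyond t = around (suc (L + toℕ t) + i)

        beyond-injective : Inj beyond
        beyond-injective {s} {t} eq = toℕ-injective (+-cancelˡ-≡ L _ _
          (ℕ.suc-injective (around-injective i (bound s) (bound t) eq)))

        beyond-misses : ∀ s → s ≤ L → ∀ t → beyond t ≢ around (s + i)
        beyond-misses s s≤L t = ≢-sym (around-distinct i (s≤s (≤-trans s≤L (m≤m+n L (toℕ t))))
          (≤-trans (bound t) (m≤m+n k s)))

      arcUp : Arc (around i) (around (L + i))
      arcUp = record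
        { path = run _ L ; reduced = reduced-around i L ; ends = end-run _ L
        ; onC = All-run _ L (λ s _ → around-OnC (s + i))
        ; missed = beyond ; missed-injective = beyond-injective ; missed-onC = λ t → around-OnC (suc (L + toℕ t) + i)
        ; misses = All-run _ L beyond-misses }

      arcDown : Arc (around (L + i)) (around i)
      arcDown = record
        { path = runDown _ L ; reduced = reduced-aroundDown i L ; ends = end-runDown _ L
        ; onC = All-runDown _ L (λ s _ → around-OnC (s + i))
        ; missed = beyond ; missed-injective = beyond-injective ; missed-onC = λ t → around-OnC (suc (L + toℕ t) + i)
        ; misses = All-runDown _ L beyond-misses }

    private
      -- If the segment from `a` to `b` is too long to miss κ + 1 vertices, then by `gap` it has at
      -- least κ + 2 steps, and the complementary arc is short enough.
      arcs-≤ : ∀ {a b} → a ≤ b → b ≤ k → Arc (around a) (around b) × Arc (around b) (around a)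
      arcs-≤ {a} {b} a≤b b≤k with (b ∸ a) + (2 + κ) ≤? g
      ... | yes small = subst (λ t → Arc (around a) (around t) × Arc (around t) (around a)) (m∸n+n≡m a≤b)
                          (arcUp a (b ∸ a) small , arcDown a (b ∸ a) small)
      ... | no big = subst (λ v → Arc v (around b) × Arc (around b) v) wrap
                       (arcDown b (g ∸ (b ∸ a)) small , arcUp b (g ∸ (b ∸ a)) small)
        where
        d = b ∸ a
        d≤g : d ≤ g
        d≤g = ≤-trans (m∸n≤m b a) (m≤n⇒m≤1+n b≤k)

        large : 2 + κ ≤ d
        large = +-cancelʳ-≤ (2 + κ) (2 + κ) d (≤-trans
          (≤-reflexive (cong (2 +_) (trans (+-suc κ (suc κ)) (cong suc (+-suc κ κ)))))
          (≤-trans (s≤s gap) (≰⇒> big)))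

        small : (g ∸ d) + (2 + κ) ≤ g
        small = ≤-trans (+-monoʳ-≤ (g ∸ d) large) (≤-reflexive (m∸n+n≡m d≤g))

        wrap : around (g ∸ d + b) ≡ around a
        wrap = trans (cong around (trans (cong (g ∸ d +_) (≡-sym (m∸n+n≡m a≤b)))
                  (trans (≡-sym (+-assoc (g ∸ d) d a)) (trans (cong (_+ a) (m∸n+n≡m d≤g)) (+-comm g a)))))
                (around-period a)

    arc : ∀ {u v} → OnC u → OnC v → Arc u v
    arc u-on v-on with OnC-around u-on | OnC-around v-on
    ... | a , a≤k , refl | b , b≤k , refl with ≤-total a b
    ...   | inj₁ a≤b = proj₁ (arcs-≤ a≤b b≤k)
    ...   | inj₂ b≤a = proj₂ (arcs-≤ b≤a a≤k)

    data Ear : List V → Set where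
      [_] : ∀ {v} → OnC v → Ear (v ∷ [])
      _∷_ : ∀ {u p} → Off u → Ear p → Ear (u ∷ p)

    ear-end : ∀ {v u p} → Ear (u ∷ p) → OnC (end v (u ∷ p))
    ear-end [ on ]            = on
    ear-end (_ ∷ [ on ])      = on
    ear-end {u = u} (_ ∷ e@(_ ∷ _)) = ear-end {v = u} e

    ear-All : ∀ {P : V → Set} v {p} → Ear p → (∀ {x} → Off x → P x) → P (end v p) → All P p
    ear-All v [ _ ]           off last = last ∷ []
    ear-All v (_∷_ {u} o e) off last = off o ∷ ear-All u e off last

    -- The ear and the arc joining its ends both avoid the vertices missed by the arc, so they
    -- coincide; but the arc stays on C.
    no-ear : ∀ {v u p} → OnC v → Off u → Ear p → ¬ Reduced G (v ∷ u ∷ p)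
    no-ear {v} {u} {p} v-on u-off ear red = u-off (All.head (All.tail
        (subst (λ q → All OnC (v ∷ q)) (≡-sym same) A.onC)))
      where
      module A = Arc (arc v-on (ear-end {v = v} (u-off ∷ ear)))
      off-fine : ∀ {x} → Off x → ∀ t → A.missed t ≢ x
      off-fine off t refl = off (A.missed-onC t)
      same : u ∷ p ≡ A.path
      same = reduced-unique G (acyclic-missing A.missed-injective (λ j S → S j refl)) v _ _ red A.reduced
        (All.head A.misses ∷ ear-All v (u-off ∷ ear) off-fine
          (subst (λ x → ∀ t → A.missed t ≢ x) A.ends (end-All v A.path A.misses)))
        A.misses (≡-sym A.ends)

    exit-ear : ∀ (z : ℕ → V) d → Off (z 0) → OnC (z d) → ∃[ L ] Ear (run z (suc L))
    exit-ear z zero    off on = contradiction on off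
    exit-ear z (suc d) off on with OnC? (z 1)
    ... | yes on₁ = 0 , [ on₁ ]
    ... | no off₁ = let (L , ear) = exit-ear (z ∘ suc) d off₁ on in suc L , off₁ ∷ ear

    module _ {l} (3≤ : 3 ≤ suc l) {z : Fin (suc l) → V} (z-cyc : IsCycle G l z) where

      private
        module D = Around G 3≤ z-cyc

        stay : ∀ d t → OnC (D.around t) → OnC (D.around (d + t))
        stay zero    t on = on
        stay (suc d) t on with OnC? (D.around (suc d + t))
        ... | yes on′ = on′
        ... | no off with exit-ear (λ s → D.around (suc s + (d + t))) l off
                            (subst OnC (≡-sym (trans (cong D.around (+-comm (suc l) (d + t))) (D.around-period (d + t))))
                              (stay d t on))
        ...   | L , ear = contradiction (D.reduced-around (d + t) (2 + L)) (no-ear (stay d t on) off ear)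

      -- If the cycle stepped off C, following it for a full turn would bring it back to C and
      -- produce an ear. Hence being on C propagates forward, which is `stay`.
      cycle-on-or-off : (∀ i → OnC (z i)) ⊎ (∀ i → Off (z i))
      cycle-on-or-off with OnC? (z zero)
      ... | yes on = inj₁ λ i → subst OnC (trans (cong D.around (+-identityʳ (toℕ i))) (D.around-toℕ i))
                                  (stay (toℕ i) 0 on)
      ... | no off = inj₂ λ i on → off (subst OnC (trans (cong D.around (m∸n+n≡m (<⇒≤ (toℕ<n i)))) (D.around-period 0))
              (stay (suc l ∸ toℕ i) (toℕ i) (subst OnC (≡-sym (D.around-toℕ i)) on)))

    κ<g : κ < g
    κ<g = ≤-trans (s≤s (m≤m+n κ κ)) (≤-trans (m≤n+m _ 2) gap)

    -- A cycle on C misses `x` and the κ vertices off C; a cycle off C misses all of C, which has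
    -- more than κ vertices. Both contradict `cycle-meets`.
    no-cycle-minus : ∀ {x} → OnC x → ¬ CycleIn G (_≢ x)
    no-cycle-minus {x} x-on (l , 3≤ , z , z-cyc , z≢x) with cycle-on-or-off 3≤ z-cyc
    ... | inj₁ on = cycle-meets 3≤ z-cyc {x ◂ Outside.element}
              (◂-injective Outside.injective (λ i eq → Outside.sound i (subst OnC (≡-sym eq) x-on)))
              λ { i zero → z≢x i ; i (suc j) eq → Outside.sound j (subst OnC eq (on i)) }
    ... | inj₂ off = cycle-meets 3≤ z-cyc {λ t → c (inject≤ t κ<g)}
              (λ eq → inject≤-injective κ<g κ<g _ _ (proj₁ cyc eq))
              λ i j eq → off i (inject≤ j κ<g , ≡-sym eq)

    acyclic-minus : ∀ {x} → OnC x → Acyclic G (_≢ x)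
    acyclic-minus x-on = acyclic G (no-cycle-minus x-on)

    -- Paths that leave C, and the vertices of C they single out.

    record Tip (u v : V) (j : ℕ) : Set where
      field
        path    : List V
        reduced : Reduced G (v ∷ path)
        off     : All Off path
        len     : length path ≡ j
        ends    : end v path ≡ u

    -- The arc from `w` to `v` followed by the first path, and the second path itself, are reduced
    -- walks from `w` to `u` that avoid a vertex of C, so they agree. As the second path has no
    -- later vertex on C, the arc is trivial.
    tip-unique : ∀ {u v w i j} → OnC v → OnC w → Tip u v i → Tip u w j → v ≡ w × i ≡ j
    tip-unique {u} {v} {w} {i} {j} v-on w-on P Q = conclude A.path A.ends A.onC same
      where
      module P = Tip P
      module Q = Tip Q
      module A = Arc (arc w-on v-on)
      x = A.missed zero
      off-fine : ∀ {y} → Off y → y ≢ x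
      off-fine off refl = off (A.missed-onC zero)
      fine : All (_≢ x) (w ∷ A.path)
      fine = All.map (λ m eq → m zero (≡-sym eq)) A.misses
      junction : ∀ {p y} → All Off p → OnC y → HeadNot y p
      junction []        on = []
      junction (off ∷ _) on = [ (λ { refl → off on }) ]
      same : A.path ++ P.path ≡ Q.path
      same = reduced-unique G (acyclic-minus (A.missed-onC zero)) w _ _
        (reduced-++ G w A.path A.reduced (subst (λ y → Reduced G (y ∷ P.path)) (≡-sym A.ends) P.reduced)
          (All.map (junction P.off) A.onC))
        Q.reduced
        (All.++⁺ fine (All.map off-fine P.off))
        (All.head fine ∷ All.map off-fine Q.off)
        (trans (end-++ w A.path) (trans (cong (λ y → end y P.path) A.ends) (trans P.ends (≡-sym Q.ends))))
      conclude : ∀ r → end w r ≡ v → All OnC (w ∷ r) → r ++ P.path ≡ Q.path → v ≡ w × i ≡ j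
      conclude []      eq _ same = ≡-sym eq , trans (≡-sym P.len) (trans (cong length same) Q.len)
      conclude (b ∷ r) _ (_ ∷ b-on ∷ _) same =
        contradiction b-on (All.head (subst (All Off) (≡-sym same) Q.off))

    one-foot : ∀ {u v w} → OnC v → OnC w → Off u → Adj G v u → Adj G w u → v ≡ w
    one-foot v-on w-on off vu wu = proj₁ (tip-unique v-on w-on (leg vu) (leg wu))
      where
      leg : ∀ {v} → Adj G v _ → Tip _ v 1
      leg vu = record { path = _ ∷ [] ; reduced = step vu [] [-] ; off = off ∷ [] ; len = refl ; ends = refl }

    split-first : ∀ q → All Off q ⊎ (∃[ A ] ∃[ v ] ∃[ R ] q ≡ A ++ v ∷ R × All Off A × OnC v)
    split-first [] = inj₁ []
    split-first (v ∷ q) with OnC? v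
    ... | yes on = inj₂ ([] , v , q , refl , [] , on)
    ... | no off with split-first q
    ...   | inj₁ offs = inj₁ (off ∷ offs)
    ...   | inj₂ (A , w , R , eq , offs , on) = inj₂ (v ∷ A , w , R , cong (v ∷_) eq , off ∷ offs , on)

    split-last : ∀ v R → All Off R ⊎ (∃[ M ] ∃[ B ] R ≡ M ++ B × OnC (end v M) × All Off B)
    split-last v [] = inj₁ []
    split-last v (r ∷ R) with split-last r R
    ... | inj₂ (M , B , eq , on , offs) = inj₂ (r ∷ M , B , cong (r ∷_) eq , on , offs)
    ... | inj₁ offs with OnC? r
    ...   | yes on = inj₂ (r ∷ [] , R , refl , on , offs)
    ...   | no off = inj₁ (off ∷ offs)

    position : ∀ {v a} → a ≤ k → OnC v → ∃[ j ] j ≤ k × v ≡ around (j + a)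
    position {v} {a} a≤k on with OnC-around on
    ... | b , b≤k , refl with a ≤? b
    ...   | yes a≤b = b ∸ a , ≤-trans (m∸n≤m b a) b≤k , cong around (≡-sym (m∸n+n≡m a≤b))
    -- A full turn is added first, so that the subtraction does not truncate.
    ...   | no a≰b = (b + g) ∸ a
                   , m≤n+o⇒m∸n≤o (b + g) a (≤-trans (≤-reflexive (+-suc b k)) (+-monoˡ-≤ k (≰⇒> a≰b)))
                   , trans (≡-sym (around-period b)) (cong around (≡-sym (m∸n+n≡m (≤-trans a≤k (≤-trans (n≤1+n k) (m≤n+m g b))))))

    -- x lies before, respectively after, the foot of u on C, at the same distance as u.
    Before After Marks : V → V → Set
    Before u x = ∃[ a ] ∃[ j ] x ≡ around a × Tip u (around (j + a)) j
    After  u x = ∃[ b ] ∃[ j ] x ≡ around (j + b) × Tip u (around b) j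
    Marks  u x = Before u x ⊎ After u x

    -- The foot and the distance are determined by `u`, and stepping back from the foot determines
    -- `x`.
    before-unique : ∀ {u x y} → Before u x → Before u y → x ≡ y
    before-unique (a , j , refl , t) (a′ , j′ , refl , t′)
      with tip-unique (around-OnC (j + a)) (around-OnC (j′ + a′)) t t′
    ... | eq , refl = around-cancel j eq

    after-unique : ∀ {u x y} → After u x → After u y → x ≡ y
    after-unique (b , j , refl , t) (b′ , j′ , refl , t′)
      with tip-unique (around-OnC b) (around-OnC b′) t t′
    ... | eq , refl = around-+ j eq

    tip-take : ∀ j {v us} → suc j ≤ length us → Reduced G (v ∷ us) → All Off us → ∃[ u ] Off u × Tip u v (suc j)
    tip-take j {v} {u ∷ us} j< red offs@(off ∷ offs′) =
      end u (take j us) , end-All u (take j us) (off ∷ All.take⁺ j offs′) , record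
        { path = u ∷ take j us ; reduced = reduced-take G (suc j) v (u ∷ us) red ; off = off ∷ All.take⁺ j offs′
        ; len = trans (length-take (suc j) (u ∷ us)) (m≤n⇒m⊓n≡m j<) ; ends = refl }

    -- From `around a`, the foot of `us` is `suc j` steps ahead, that of `vs` another `d`, and
    -- `suc e` more complete the turn. If `us` and `vs` had at most `j` and `e` vertices, then with
    -- the `suc d` vertices between them the total would be below `g`.
    mark-ends : ∀ {a us vs} j d e → suc j + d + suc e ≡ g → length us + length vs + suc d ≡ g →
      Reduced G (around (suc j + a) ∷ us) → All Off us →
      Reduced G (around (d + (suc j + a)) ∷ vs) → All Off vs →
      ∃[ u ] Off u × Marks u (around a)
    mark-ends {a} {us} {vs} j d e eq len rus us-off rvs vs-off with suc j ≤? length us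
    ... | yes j≤ = let (u , off , tip) = tip-take j j≤ rus us-off in u , off , inj₁ (a , suc j , refl , tip)
    ... | no j≰ with suc e ≤? length vs
    ...   | yes e≤ = let (u , off , tip) = tip-take e e≤ rvs vs-off in
              u , off , inj₂ (d + (suc j + a) , suc e , trans (≡-sym (around-period a)) (cong around wrap) , tip)
      where
      wrap : a + g ≡ suc e + (d + (suc j + a))
      wrap = trans (cong (a +_) (≡-sym eq))
        (solve 4 (λ a j d e → a :+ (j :+ d :+ e) := e :+ (d :+ (j :+ a))) refl a (suc j) d (suc e))
        where open +-*-Solver
    ...   | no e≰ = contradiction (trans len (≡-sym eq)) (<⇒≢ (≤-trans
              (s≤s (+-monoˡ-≤ (suc d) (+-mono-≤ (s≤s⁻¹ (≰⇒> j≰)) (s≤s⁻¹ (≰⇒> e≰)))))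
              (≤-reflexive (solve 3 (λ j d e → con 1 :+ (j :+ e :+ (con 1 :+ d)) := (con 1 :+ j) :+ d :+ (con 1 :+ e)) refl j d e))))
      where open +-*-Solver

    segment-avoids : ∀ a j d → suc j + d ≤ k → ∀ s → s ≤ d → around (s + (suc j + a)) ≢ around a
    segment-avoids a j d ≤k s s≤d eq = around-distinct {0} {s + suc j} a
      (subst (0 <_) (≡-sym (+-suc s j)) z<s)
      (≤-trans (+-monoˡ-≤ (suc j) s≤d) (≤-trans (≤-reflexive (+-comm d (suc j))) (≤-trans ≤k (m≤m+n k 0))))
      (trans (≡-sym eq) (cong around (≡-sym (+-assoc s (suc j) a))))

    -- The part of a long path between its first and its last vertex on C runs along C, so one of the
    -- two remaining pieces is at least as long as the distance on C from its foot to the avoided vertex.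
    mark : ∀ {x} → OnC x → ∀ q → Reduced G q → All (_≢ x) q → length q ≡ g → ∃[ u ] Off u × Marks u x
    mark x-on q red q≢x len with split-first q
    -- A path entirely off C would have `g` distinct vertices among only κ.
    ... | inj₁ offs = contradiction (injective⇒≤ {f = λ i → proj₁ (index i)} λ {i} {j} eq →
            Unique-lookup-injective (acyclic-minus x-on q red q≢x)
              (trans (≡-sym (proj₂ (index i))) (trans (cong Outside.element eq) (proj₂ (index j)))))
            (<⇒≱ (subst (κ <_) (≡-sym len) κ<g))
      where
      index : ∀ i → ∃[ t ] Outside.element t ≡ lookup q i
      index i = off-index (All.lookup offs (∈-lookup i))
    ... | inj₂ (A , v , R , refl , A-off , v-on) with OnC-around x-on | position-split v R v-on
      where
      position-split : ∀ v R → OnC v → ∃[ M ] ∃[ B ] R ≡ M ++ B × OnC (end v M) × All Off B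
      position-split v R on with split-last v R
      ... | inj₁ offs = [] , R , refl , on , offs
      ... | inj₂ s    = s
    ...   | a , a≤k , refl | M , B , refl , w-on , B-off
      with position a≤k v-on | position {end v M} a≤k w-on
    ...   | zero , _ , v≡x | _ = contradiction v≡x (All.head (All.++⁻ʳ A q≢x))
    ...   | suc i , i≤k , refl | zero , _ , w≡x =
              contradiction w≡x (end-All v M (All.++⁻ˡ (v ∷ M) (All.++⁻ʳ A q≢x)))
    ...   | suc i , i≤k , refl | suc j , j≤k , w≡ = by-order (≤-total i j)
      where
      x = around a
      us = A ʳ++ []
      vM≢x : All (_≢ x) (v ∷ M)
      vM≢x = All.++⁻ˡ (v ∷ M) (All.++⁻ʳ A q≢x)
      rvMB : Reduced G (v ∷ M ++ B)
      rvMB = reduced-suffix G A red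
      rvM : Reduced G (v ∷ M)
      rvM = reduced-prefix G (v ∷ M) rvMB
      rus : Reduced G (v ∷ us)
      rus = subst (Reduced G) (++-ʳ++ A) (reduced-reverse G (A ++ v ∷ [])
        (reduced-prefix G (A ++ v ∷ []) (subst (Reduced G) (≡-sym (++-assoc A (v ∷ []) (M ++ B))) red)))
      us-off : All Off us
      us-off = All-ʳ++ A-off []
      rvs : Reduced G (around (suc j + a) ∷ B)
      rvs = subst (λ w → Reduced G (w ∷ B)) w≡ (reduced-from-end G v M rvMB)
      total : length us + length B + suc (length M) ≡ g
      total = trans (cong (λ t → t + length B + suc (length M)) (trans (length-ʳ++ A) (+-identityʳ _)))
        (trans (solve 3 (λ A B M → A :+ B :+ (con 1 :+ M) := A :+ (con 1 :+ (M :+ B))) refl (length A) (length B) (length M))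
        (trans (cong (λ t → length A + suc t) (≡-sym (length-++ M))) (trans (≡-sym (length-++ A)) len)))
        where open +-*-Solver
      rest : ∀ {t} → t ≤ k → t + suc (k ∸ t) ≡ g
      rest {t} t≤k = trans (+-suc t (k ∸ t)) (cong suc (m+[n∸m]≡n t≤k))

      -- The feet lie `suc i` and `suc j` steps after `x`. Their order decides whether `M` runs up
      -- or down along C; in the second case the two outer pieces exchange roles.
      by-order : i ≤ j ⊎ j ≤ i → ∃[ u ] Off u × Marks u x
      by-order (inj₁ i≤j) = mark-ends i d (k ∸ suc j) (trans (cong (_+ suc (k ∸ suc j)) i+d) (rest j≤k))
          (subst (λ t → length us + length B + suc t ≡ g) M-length total)
          rus us-off (subst (λ t → Reduced G (around t ∷ B)) (≡-sym end-pos) rvs) B-off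
        where
        d = j ∸ i
        i+d : suc i + d ≡ suc j
        i+d = cong suc (m+[n∸m]≡n i≤j)
        end-pos : d + (suc i + a) ≡ suc j + a
        end-pos = trans (≡-sym (+-assoc d (suc i) a)) (cong (_+ a) (trans (+-comm d (suc i)) i+d))
        z = λ t → around (t + (suc i + a))
        M-length : length M ≡ d
        M-length = trans (cong length (reduced-unique G (acyclic-minus (around-OnC a)) v M (run z d) rvM
            (reduced-around (suc i + a) d) vM≢x
            (All-run z d (segment-avoids a i d (subst (_≤ k) (≡-sym i+d) j≤k)))
            (trans w≡ (≡-sym (trans (end-run z d) (cong around end-pos))))))
          (length-run z d)
      by-order (inj₂ j≤i) = mark-ends j d (k ∸ suc i) (trans (cong (_+ suc (k ∸ suc i)) j+d) (rest i≤k))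
          (trans (cong (_+ suc d) (+-comm (length B) (length us)))
            (subst (λ t → length us + length B + suc t ≡ g) M-length total))
          rvs B-off (subst (λ t → Reduced G (around t ∷ us)) (≡-sym end-pos) rus) us-off
        where
        d = i ∸ j
        j+d : suc j + d ≡ suc i
        j+d = cong suc (m+[n∸m]≡n j≤i)
        end-pos : d + (suc j + a) ≡ suc i + a
        end-pos = trans (≡-sym (+-assoc d (suc j) a)) (cong (_+ a) (trans (+-comm d (suc j)) j+d))
        z = λ t → around (t + (suc j + a))
        M-length : length M ≡ d
        M-length = trans (cong length (reduced-unique G (acyclic-minus (around-OnC a)) v M (runDown z d) rvM
            (subst (λ t → Reduced G (around t ∷ runDown z d)) end-pos (reduced-aroundDown (suc j + a) d)) vM≢x
            (subst (λ t → All (_≢ x) (around t ∷ runDown z d)) end-pos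
              (All-runDown z d (segment-avoids a j d (subst (_≤ k) (≡-sym j+d) i≤k))))
            (trans w≡ (≡-sym (trans (cong (λ t → end (around t) (runDown z d)) (≡-sym end-pos)) (end-runDown z d))))))
          (length-runDown z d)

    -- Each of the κ vertices off C marks at most one vertex of C in each of the two directions.
    long-paths-bound : ∀ {m} {x : Fin m → V} → Inj x → (∀ i → OnC (x i)) →
      (∀ i → ∃[ q ] Reduced G q × All (_≢ x i) q × length q ≡ g) → m ≤ κ + κ
    long-paths-bound {m} {x} x-inj x-on paths =
      injective⇒≤ {f = λ i → join κ κ (code (marked i))} λ {i} {j} eq →
        x-inj (code-injective (marked i) (marked j) (join-injective κ κ eq))
      where
      Marked : V → Set
      Marked y = ∃[ u ] Off u × Marks u y
      marked : ∀ i → Marked (x i)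
      marked i = let (q , red , q≢ , len) = paths i in mark (x-on i) q red q≢ len
      code : ∀ {y} → Marked y → Fin κ ⊎ Fin κ
      code (u , off , inj₁ _) = inj₁ (proj₁ (off-index off))
      code (u , off , inj₂ _) = inj₂ (proj₁ (off-index off))
      off-index-injective : ∀ {u v} (p : Off u) (q : Off v) → proj₁ (off-index p) ≡ proj₁ (off-index q) → u ≡ v
      off-index-injective p q eq = trans (≡-sym (proj₂ (off-index p))) (trans (cong Outside.element eq) (proj₂ (off-index q)))
      code-injective : ∀ {y y′} (s : Marked y) (t : Marked y′) → code s ≡ code t → y ≡ y′
      code-injective (u , p , inj₁ s) (v , q , inj₁ t) eq with off-index-injective p q (inj₁-inj eq)
        where inj₁-inj : ∀ {i j : Fin κ} → inj₁ {B = Fin κ} i ≡ inj₁ j → i ≡ j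
              inj₁-inj refl = refl
      ... | refl = before-unique s t
      code-injective (u , p , inj₁ s) (v , q , inj₂ t) ()
      code-injective (u , p , inj₂ s) (v , q , inj₁ t) ()
      code-injective (u , p , inj₂ s) (v , q , inj₂ t) eq with off-index-injective p q (inj₂-inj eq)
        where inj₂-inj : ∀ {i j : Fin κ} → inj₂ {A = Fin κ} i ≡ inj₂ j → i ≡ j
              inj₂-inj refl = refl
      ... | refl = after-unique s t

-- Transport along isomorphic cards.

-- An isomorphism G − x ≅ H − y, extended by x ↦ y to a permutation of all vertices.
record CardMatch (G H : Graph n) (x y : Fin n) : Set where
  field
    π         : Permutation n n
    π-x       : π ⟨$⟩ʳ x ≡ y
    preserves : ∀ u v → u ≢ x → v ≢ x → adj H (π ⟨$⟩ʳ u) (π ⟨$⟩ʳ v) ≡ adj G u v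

  to from : Fin n → Fin n
  to   = π ⟨$⟩ʳ_
  from = π ⟨$⟩ˡ_

  to-injective : Inj to
  to-injective eq = trans (≡-sym (inverseˡ π)) (trans (cong from eq) (inverseˡ π))

  from-injective : Inj from
  from-injective eq = trans (≡-sym (inverseʳ π)) (trans (cong to eq) (inverseʳ π))

  from-y : from y ≡ x
  from-y = trans (cong from (≡-sym π-x)) (inverseˡ π)

  to-≢ : ∀ {v} → v ≢ x → to v ≢ y
  to-≢ v≢x eq = v≢x (to-injective (trans eq (≡-sym π-x)))

  from-≢ : ∀ {v} → v ≢ y → from v ≢ x
  from-≢ v≢y eq = v≢y (from-injective (trans eq (≡-sym from-y)))

  to-adj : ∀ {u v} → u ≢ x → v ≢ x → Adj G u v → Adj H (to u) (to v)
  to-adj u≢ v≢ = trans (preserves _ _ u≢ v≢)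

card-match : (G H : Graph (suc n)) (x y : Fin (suc n)) → card G x ≅ card H y → CardMatch G H x y
card-match G H x y (f , f-adj) = record { π = π ; π-x = π-x ; preserves = preserves }
  where
  π₀ = ⤖⇒↔ f
  π = insert x y π₀
  π-x : π ⟨$⟩ʳ x ≡ y
  π-x with x ≟ x
  ... | yes _ = refl
  ... | no x≢x = contradiction refl x≢x
  preserves : ∀ u v → u ≢ x → v ≢ x → adj H (π ⟨$⟩ʳ u) (π ⟨$⟩ʳ v) ≡ adj G u v
  preserves u v u≢x v≢x
    rewrite ≡-sym (punchIn-punchOut {i = x} (≢-sym u≢x)) | ≡-sym (punchIn-punchOut {i = x} (≢-sym v≢x))
          | insert-punchIn x y π₀ (punchOut (≢-sym u≢x)) | insert-punchIn x y π₀ (punchOut (≢-sym v≢x))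
    = f-adj _ _

match-sym : {G H : Graph n} {x y : Fin n} → CardMatch G H x y → CardMatch H G y x
match-sym {G = G} {H} M = record
  { π = flip π ; π-x = from-y
  ; preserves = λ u v u≢ v≢ → ≡-sym (trans (cong₂ (adj H) (≡-sym (inverseʳ π)) (≡-sym (inverseʳ π)))
      (preserves (from u) (from v) (from-≢ u≢) (from-≢ v≢))) }
  where open CardMatch M

module _ {G H : Graph n} {x y : Fin n} (M : CardMatch G H x y) where
  open CardMatch M

  cycle-map : ∀ {k z} → IsCycle G k z → (∀ i → z i ≢ x) → IsCycle H k (to ∘ z)
  cycle-map (z-inj , z-adj , z-last) z≢x =
    (λ eq → z-inj (to-injective eq)) , (λ i → to-adj (z≢x _) (z≢x _) (z-adj i)) , to-adj (z≢x _) (z≢x _) z-last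

  reduced-map : ∀ xs → Reduced G xs → All (_≢ x) xs → Reduced H (map to xs)
  reduced-map [] _ _ = []
  reduced-map (u ∷ []) _ _ = [-]
  reduced-map (u ∷ v ∷ []) (step uv _ r) (u≢ ∷ v≢ ∷ _) = step (to-adj u≢ v≢ uv) [] [-]
  reduced-map (u ∷ v ∷ w ∷ xs) (step uv [ u≢w ] r) (u≢ ∷ v≢ ∷ all) =
    step (to-adj u≢ v≢ uv) [ u≢w ∘ to-injective ] (reduced-map (v ∷ w ∷ xs) r (v≢ ∷ all))

-- Walks inside a vertex set, and branching vertices.

data Walk (X : Graph n) (S : Fin n → Set) : Fin n → Fin n → Set where
  [_]    : ∀ {v} → S v → Walk X S v v
  _∷⟨_⟩_ : ∀ {u v w} → S u → Adj X u v → Walk X S v w → Walk X S u w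

infixr 5 _∷⟨_⟩_

module _ {X : Graph n} {S : Fin n → Set} where

  walk-start : ∀ {u v} → Walk X S u v → S u
  walk-start [ s ]       = s
  walk-start (s ∷⟨ _ ⟩ _) = s

  walk-end : ∀ {u v} → Walk X S u v → S v
  walk-end [ s ]       = s
  walk-end (_ ∷⟨ _ ⟩ p) = walk-end p

  walk-trans : ∀ {u v w} → Walk X S u v → Walk X S v w → Walk X S u w
  walk-trans [ _ ]        q = q
  walk-trans (s ∷⟨ uv ⟩ p) q = s ∷⟨ uv ⟩ walk-trans p q

  walk-sym : ∀ {u v} → Walk X S u v → Walk X S v u
  walk-sym [ s ]        = [ s ]
  walk-sym (s ∷⟨ uv ⟩ p) = walk-trans (walk-sym p) (walk-start p ∷⟨ Adj-sym X uv ⟩ [ s ])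

  walk-closed : ∀ {P : Fin n → Set} → (∀ {a b} → P a → Adj X a b → S b → P b) →
    ∀ {u v} → Walk X S u v → P u → P v
  walk-closed closed [ _ ]        pu = pu
  walk-closed closed (_ ∷⟨ uv ⟩ p) pu = walk-closed closed p (closed pu uv (walk-start p))

  walk-departs : ∀ {u v} → Walk X S u v → u ≢ v → ∃[ w ] Adj X u w × S w
  walk-departs [ _ ]        u≢u = contradiction refl u≢u
  walk-departs (_ ∷⟨ uw ⟩ p) _   = _ , uw , walk-start p

  walk-reduced : ∀ {u v} → Walk X S u v → ∃[ p ] Reduced X (u ∷ p) × All S (u ∷ p) × end u p ≡ v
  walk-reduced [ s ] = [] , [-] , s ∷ [] , refl
  walk-reduced {u} (_∷⟨_⟩_ {v = v} s uv q) with walk-reduced q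
  ... | [] , r , ss , eq = v ∷ [] , step uv [] r , s ∷ ss , eq
  ... | w ∷ p , r , ss , eq with u ≟ w
  -- The detour from `u` to `v` and back is cancelled.
  ...   | yes refl = p , tail-reduced X r , All.tail ss , eq
  ...   | no u≢w   = v ∷ w ∷ p , step uv [ u≢w ] r , s ∷ ss , eq

walk-map : {X Y : Graph n} {S T : Fin n → Set} (f : Fin n → Fin n) → (∀ {v} → S v → T (f v)) →
  (∀ {u v} → S u → S v → Adj X u v → Adj Y (f u) (f v)) → ∀ {u v} → Walk X S u v → Walk Y T (f u) (f v)
walk-map f fS fA [ s ]        = [ fS s ]
walk-map f fS fA (s ∷⟨ uv ⟩ p) = fS s ∷⟨ fA s (walk-start p) uv ⟩ walk-map f fS fA p

-- This is degree at least two. The leaves below are the non-branching vertices, which include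
-- isolated ones.
Branching : Graph n → Fin n → Set
Branching X v = ∃[ a ] ∃[ b ] Adj X v a × Adj X v b × a ≢ b

Adj? : (X : Graph n) (u v : Fin n) → Dec (Adj X u v)
Adj? X u v = adj X u v Bool.≟ true

Branching? : (X : Graph n) → Decidable (Branching X)
Branching? X v = any? λ a → any? λ b → Adj? X v a ×-dec Adj? X v b ×-dec ¬? (a ≟ b)

other-neighbour : (X : Graph n) {v : Fin n} → Branching X v → ∀ p → ∃[ w ] Adj X v w × w ≢ p
other-neighbour X (a , b , va , vb , a≢b) p with a ≟ p
... | yes refl = b , vb , ≢-sym a≢b
... | no a≢p   = a , va , a≢p

Unique-head : {A : Set} {v w : A} {xs : List A} → Unique (v ∷ xs) → w ∈ xs → v ≢ w
Unique-head (v≢ ∷ _) w∈ refl = All.lookup v≢ w∈ refl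

-- Comparison of G with a graph H whose cycles are all longer than C.

module Compare {n} (G H : Graph n) {k} (3≤g : 3 ≤ suc k) {c : Fin (suc k) → Fin n} (cyc : IsCycle G k c)
  (shortest : ∀ l → HasCycle G l → suc k ≤ l) (H-girth : ∀ l → HasCycle H l → suc k < l)
  {m} (2n+3≤3m : 2 * n + 3 ≤ 3 * m) {x y : Fin m → Fin n} (x-inj : Inj x) (y-inj : Inj y)
  (match : ∀ i → CardMatch G H (x i) (y i)) where

  open Cycle G 3≤g cyc

  x-on : ∀ i → OnC (x i)
  x-on i with OnC? (x i)
  ... | yes on = on
  ... | no off = contradiction
    (H-girth g (3≤g , _ , cycle-map (match i) cyc (λ j eq → off (j , eq)))) (<-irrefl refl)

  m≤g : m ≤ g
  m≤g = injective⇒≤ {f = λ i → proj₁ (x-on i)} λ {i} {j} eq →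
    x-inj (trans (≡-sym (proj₂ (x-on i))) (trans (cong c eq) (proj₂ (x-on j))))

  3+2κ≤m : 3 + (κ + κ) ≤ m
  3+2κ≤m = +-cancelˡ-≤ (2 * g) _ _ (begin
    2 * g + (3 + (κ + κ)) ≡⟨ solve 2 (λ g κ → con 2 :* g :+ (con 3 :+ (κ :+ κ)) := con 2 :* (g :+ κ) :+ con 3) refl g κ ⟩
    2 * (g + κ) + 3       ≤⟨ +-monoˡ-≤ 3 (*-monoʳ-≤ 2 g+κ≤n) ⟩
    2 * n + 3             ≤⟨ 2n+3≤3m ⟩
    3 * m                 ≡⟨ +-comm m (2 * m) ⟩
    2 * m + m             ≤⟨ +-monoˡ-≤ m (*-monoʳ-≤ 2 m≤g) ⟩
    2 * g + m             ∎)
    where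
    open ≤-Reasoning
    open +-*-Solver

  gap : 3 + (κ + κ) ≤ g
  gap = ≤-trans 3+2κ≤m m≤g

  open Shortest shortest gap

  module _ (i : Fin m) where
    open CardMatch (match i) public using ()
      renaming (to to to; from to from; to-injective to to-injective; from-injective to from-injective)

  -- A cycle of H passes through every y i, so removing y i leaves a path with at least g vertices.
  H-no-cycle : ∀ l → ¬ HasCycle H l
  H-no-cycle (suc l) cycle@(3≤l , z , z-cyc) = <⇒≱ (≤-trans (s≤s (m≤n+m _ 2)) 3+2κ≤m)
      (long-paths-bound x-inj x-on path)
    where
    module D = Around H 3≤l z-cyc
    y-on : ∀ i → ∃[ j ] z j ≡ y i
    y-on i with any? (λ j → z j ≟ y i)
    ... | yes on = on
    -- A cycle of H that misses `y i` would give a cycle of G - `x i`, which is a forest.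
    ... | no off = contradiction
      (l , 3≤l , _ , cycle-map (match-sym (match i)) z-cyc z≢y , λ j → CardMatch.from-≢ (match i) (z≢y j))
      (no-cycle-minus (x-on i))
      where
      z≢y : ∀ j → z j ≢ y i
      z≢y j eq = off (j , eq)
    path : ∀ i → ∃[ q ] Reduced G q × All (_≢ x i) q × length q ≡ g
    path i with y-on i
    ... | j , zj≡y = map (from i) q , reduced-map (match-sym (match i)) q (D.reduced-around (suc t) k) q≢y
                   , All.map⁺ (All.map (CardMatch.from-≢ (match i)) q≢y)
                   , trans (length-map (from i) q) (cong suc (length-run _ k))
      where
      t = toℕ j
      q = D.around (suc t) ∷ run (λ s → D.around (s + suc t)) k
      q≢y : All (_≢ y i) q
      -- The walk starts one step after `y i` and has `g` vertices. The cycle is longer than `g`, so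
      -- the walk stops before it returns to `y i`.
      q≢y = All-run _ k λ s s≤k eq → D.around-distinct {0} {suc s} t z<s
        (≤-trans (s≤s s≤k) (≤-trans (s≤s⁻¹ (H-girth (suc l) cycle)) (m≤m+n l 0)))
        (trans (D.around-toℕ j) (trans zj≡y (trans (≡-sym eq) (cong D.around (+-suc s t)))))

  H-acyclic : Acyclic H (λ _ → ⊤)
  H-acyclic = acyclic H λ (l , 3≤ , z , z-cyc , _) → H-no-cycle (suc l) (3≤ , z , z-cyc)

  x-around : ∀ i → ∃[ a ] a ≤ k × around a ≡ x i
  x-around i = OnC-around (x-on i)

  k≥2+2κ : 2 + (κ + κ) ≤ k
  k≥2+2κ = s≤s⁻¹ gap

  -- The non-branching vertices of G − x i are off C or one of the two neighbours of x i on C.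
  non-branching-bound : ∀ i {t} {f : Fin t → V} → Inj f → (∀ s → ¬ Branching H (f s) ⊎ f s ≡ y i) → t ≤ 3 + κ
  non-branching-bound i {t} {f} f-inj f-leaf with x-around i
  ... | a , _ , a≡ = +-cancelʳ-≤ (k ∸ 2) t (3 + κ) (begin
      t + (k ∸ 2)       ≤⟨ disjoint-injections f-inj inner-injective disjoint ⟩
      n                 ≤⟨ n≤g+κ ⟩
      suc k + κ         ≡⟨ cong (λ j → suc j + κ) (≡-sym (m+[n∸m]≡n 2≤k)) ⟩
      3 + (k ∸ 2) + κ   ≡⟨ cong (3 +_) (+-comm (k ∸ 2) κ) ⟩
      3 + κ + (k ∸ 2)   ∎)
    where
    open ≤-Reasoning
    2≤k : 2 ≤ k
    2≤k = s≤s⁻¹ 3≤g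
    at : ℕ → V
    at s = around (s + a)
    inner-bound : ∀ (s : Fin (k ∸ 2)) → 3 + toℕ s ≤ k
    inner-bound s = ≤-trans (+-monoʳ-≤ 2 (toℕ<n s)) (≤-reflexive (m+[n∸m]≡n 2≤k))
    -- These come from the vertices 2 to k - 1 steps after `x i`, both of whose neighbours on C
    -- survive in the card. Besides them there remain `y i`, two neighbours of `x i` on C and the
    -- vertices off C, whence 3 + κ.
    inner : Fin (k ∸ 2) → V
    inner s = to i (at (2 + toℕ s))
    inner-injective : Inj inner
    inner-injective {s} {s′} eq = toℕ-injective (ℕ.suc-injective (ℕ.suc-injective
      (around-injective a (<⇒≤ (inner-bound s)) (<⇒≤ (inner-bound s′)) (to-injective i eq))))
    at≢x : ∀ {s} → 0 < s → s ≤ k → at s ≢ x i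
    at≢x {s} 0<s s≤k eq = around-distinct a 0<s (≤-trans s≤k (m≤m+n k 0)) (trans a≡ (≡-sym eq))
    ≢₁ : ∀ t → at (1 + toℕ t) ≢ x i
    ≢₁ t = at≢x {1 + toℕ t} z<s (<⇒≤ (<⇒≤ (inner-bound t)))
    ≢₂ : ∀ t → at (2 + toℕ t) ≢ x i
    ≢₂ t = at≢x {2 + toℕ t} z<s (<⇒≤ (inner-bound t))
    ≢₃ : ∀ t → at (3 + toℕ t) ≢ x i
    ≢₃ t = at≢x {3 + toℕ t} z<s (inner-bound t)
    disjoint : ∀ s t → f s ≢ inner t
    disjoint s t eq with f-leaf s
    ... | inj₂ eq′ = CardMatch.to-≢ (match i) (≢₂ t) (trans (≡-sym eq) eq′)
    ... | inj₁ leaf = leaf (subst (Branching H) (≡-sym eq)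
      ( to i (at (1 + toℕ t)) , to i (at (3 + toℕ t))
      , CardMatch.to-adj (match i) (≢₂ t) (≢₁ t) (Adj-sym G (around-adj (1 + toℕ t + a)))
      , CardMatch.to-adj (match i) (≢₂ t) (≢₃ t) (around-adj (2 + toℕ t + a))
      , λ e → around-no-return (1 + toℕ t + a) (to-injective i e)))

  -- The case of a forest H: the component of C and its images.

  Foot : Fin m → Set
  Foot i = ∃[ u ] Off u × Adj G (x i) u

  Foot? : Decidable Foot
  Foot? i = any? λ u → ¬? (OnC? u) ×-dec Adj? G (x i) u

  module Feet = Enumeration (enumerate Foot?)
  module Bare = Enumeration (enumerate (¬? ∘ Foot?))

  Bare : Fin m → Set
  Bare i = ¬ Foot i

  -- By `one-foot`, different `x i` have different neighbours off C.
  few-feet : Feet.size ≤ κ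
  few-feet = injective⇒≤ {f = λ t → proj₁ (index t)} λ {s} {t} eq →
      Feet.injective (x-inj (one-foot (x-on _) (x-on _) (proj₁ (proj₂ (Feet.sound s)))
        (proj₂ (proj₂ (Feet.sound s)))
        (subst (Adj G _) (≡-sym (trans (≡-sym (proj₂ (index s))) (trans (cong Outside.element eq) (proj₂ (index t)))))
          (proj₂ (proj₂ (Feet.sound t))))))
    where
    index : ∀ t → ∃[ j ] Outside.element j ≡ proj₁ (Feet.sound t)
    index t = off-index (proj₁ (proj₂ (Feet.sound t)))

  many-bare : 3 + κ ≤ Bare.size
  many-bare = +-cancelʳ-≤ κ _ _ (≤-trans 3+2κ≤m (≤-trans (joint-cover cover) (+-monoʳ-≤ Bare.size few-feet)))
    where
    cover : ∀ i → (∃[ s ] Bare.element s ≡ i) ⊎ (∃[ t ] Feet.element t ≡ i)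
    cover i with Foot? i
    ... | yes foot = inj₂ (Feet.complete i foot)
    ... | no bare  = inj₁ (Bare.complete i bare)

  -- the connected component of C in G
  W : V → Set
  W v = ∃[ w ] OnC w × Walk G (λ _ → ⊤) v w

  OnC⊂W : ∀ {v} → OnC v → W v
  OnC⊂W on = _ , on , [ tt ]

  W-closed : ∀ {u v} → W u → Adj G u v → W v
  W-closed (w , on , p) uv = w , on , tt ∷⟨ Adj-sym G uv ⟩ p

  Wₓ : Fin m → V → Set
  Wₓ i v = W v × v ≢ x i

  -- C without `x i` is still a path, starting at `around (1 + a)`. A walk towards C from a vertex
  -- off C cannot first meet C in `x i`, as `x i` has no neighbour off C.
  W-base : ∀ i → Bare i → ∃[ b ] ∀ {v} → Wₓ i v → Walk G (Wₓ i) v b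
  W-base i bare with x-around i
  ... | a , a≤k , a≡ = around (1 + a) , λ (w∈ , v≢) → reach v≢ (proj₂ (proj₂ w∈)) (proj₁ (proj₂ w∈))
    where
    arc∈ : ∀ j → suc j ≤ k → Wₓ i (around (suc j + a))
    arc∈ j j≤k = OnC⊂W (around-OnC (suc j + a)) , λ eq →
      around-distinct {0} {suc j} a z<s (≤-trans j≤k (m≤m+n k 0)) (trans a≡ (≡-sym eq))
    along : ∀ j → suc j ≤ k → Walk G (Wₓ i) (around (suc j + a)) (around (1 + a))
    along zero    j≤k = [ arc∈ 0 j≤k ]
    along (suc j) j≤k = arc∈ (suc j) j≤k ∷⟨ Adj-sym G (around-adj (suc j + a)) ⟩ along j (<⇒≤ j≤k)
    reach : ∀ {v w} → v ≢ x i → Walk G (λ _ → ⊤) v w → OnC w → Walk G (Wₓ i) v (around (1 + a))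
    reach {v} v≢ p on with OnC? v
    ... | yes v-on with position a≤k v-on
    ...   | zero  , _   , eq = contradiction (trans eq a≡) v≢
    ...   | suc j , j≤k , eq = subst (λ u → Walk G (Wₓ i) u (around (1 + a))) (≡-sym eq) (along j j≤k)
    reach v≢ [ _ ] on | no off = contradiction on off
    reach {v} v≢ (_∷⟨_⟩_ {v = u} _ vu p) on | no off =
      ((_ , on , (tt ∷⟨ vu ⟩ p)) , v≢) ∷⟨ vu ⟩
        reach (λ u≡x → bare (v , off , subst (λ t → Adj G t v) u≡x (Adj-sym G vu))) p on

  module _ (W? : Decidable W) where

    -- the image of W − x i in H
    Wᵧ : Fin m → V → Set
    Wᵧ i v = W (from i v) × v ≢ y i

    Wᵧ? : ∀ i → Decidable (Wᵧ i)
    Wᵧ? i v = W? (from i v) ×-dec ¬? (v ≟ y i)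

    y∉Wᵧ : ∀ i → ¬ Wᵧ i (y i)
    y∉Wᵧ i (_ , y≢y) = y≢y refl

    to-Wᵧ : ∀ i {v} → Wₓ i v → Wᵧ i (to i v)
    to-Wᵧ i (w∈ , v≢x) = subst W (≡-sym (inverseˡ (CardMatch.π (match i)))) w∈ , CardMatch.to-≢ (match i) v≢x

    Wᵧ-closed : ∀ i {u v} → Wᵧ i u → Adj H u v → v ≢ y i → Wᵧ i v
    Wᵧ-closed i (w∈ , u≢) uv v≢ =
      W-closed w∈ (CardMatch.to-adj (match-sym (match i)) u≢ v≢ uv) , v≢

    Wᵧ-connected : ∀ i → Bare i → ∀ {u v} → Wᵧ i u → Wᵧ i v → Walk H (Wᵧ i) u v
    Wᵧ-connected i bare u∈ v∈ with W-base i bare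
    ... | b , base = walk-trans (to-base u∈) (walk-sym (to-base v∈))
      where
      to-base : ∀ {u} → Wᵧ i u → Walk H (Wᵧ i) u (to i b)
      to-base (w∈ , u≢) = subst (λ t → Walk H (Wᵧ i) t (to i b)) (inverseʳ (CardMatch.π (match i)))
        (walk-map (to i) (to-Wᵧ i) (λ s t → CardMatch.to-adj (match i) (proj₂ s) (proj₂ t))
          (base (w∈ , CardMatch.from-≢ (match i) u≢)))

    -- An inclusion is an equality here, since the sets Wᵧ i are images of sets of size |W| − 1.
    equal-size : ∀ i j → (∀ v → Wᵧ i v → Wᵧ j v) → ¬ Wᵧ j (y i)
    equal-size i j sub y∈ = no-proper-self-injection W? (λ v → from j (to i v))
      (λ eq → to-injective i (from-injective j eq)) (λ v v∈ → proj₁ (image v v∈))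
      (x j) (OnC⊂W (x-on j)) λ v v∈ → CardMatch.from-≢ (match j) (proj₂ (image v v∈))
      where
      image : ∀ v → W v → Wᵧ j (to i v)
      image v v∈ with v ≟ x i
      ... | yes refl = subst (Wᵧ j) (≡-sym (CardMatch.π-x (match i))) y∈
      ... | no v≢x   = sub _ (to-Wᵧ i (v∈ , v≢x))

    arcᵧ : Fin m → Fin k → V
    arcᵧ i t = to i (around (suc (toℕ t) + proj₁ (x-around i)))

    arcᵧ-injective : ∀ i → Inj (arcᵧ i)
    arcᵧ-injective i {s} {t} eq = toℕ-injective (ℕ.suc-injective
      (around-injective (proj₁ (x-around i)) (toℕ<n s) (toℕ<n t) (to-injective i eq)))

    arcᵧ∈ : ∀ i t → Wᵧ i (arcᵧ i t)
    arcᵧ∈ i t = to-Wᵧ i (OnC⊂W (around-OnC (suc (toℕ t) + a)) , λ eq →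
      around-distinct {0} {suc (toℕ t)} a z<s (≤-trans (toℕ<n t) (m≤m+n k 0)) (trans a≡ (≡-sym eq)))
      where
      a  = proj₁ (x-around i)
      a≡ = proj₂ (proj₂ (x-around i))

    -- The set `Wᵧ i` contains the `k` vertices of the image of C - `x i`, and there are at most k +
    -- 1 + κ vertices in all.
    disjoint-from-arcᵧ : ∀ i {s} {f : Fin s → V} → Inj f → (∀ t → ¬ Wᵧ i (f t)) → s ≤ suc κ
    disjoint-from-arcᵧ i {s} f-inj f∉ = +-cancelʳ-≤ k s (suc κ) (≤-trans
      (disjoint-injections f-inj (arcᵧ-injective i) λ t t′ eq → f∉ t (subst (Wᵧ i) (≡-sym eq) (arcᵧ∈ i t′)))
      (≤-trans n≤g+κ (≤-reflexive (cong suc (+-comm k κ)))))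

    -- The set `Wᵧ j` has at least k > κ + 1 vertices, too many to lie outside `Wᵧ i`.
    meet : ∀ i j → ¬ (∀ v → Wᵧ i v → ¬ Wᵧ j v)
    meet i j disj = <⇒≱ (≤-trans (s≤s (s≤s (m≤m+n κ κ))) k≥2+2κ)
      (disjoint-from-arcᵧ i (arcᵧ-injective j) λ t i∈ → disj _ i∈ (arcᵧ∈ j t))

    -- The set `Wᵧ i` is connected and meets `Wᵧ j`, and by hypothesis no step inside `Wᵧ i` leaves
    -- `Wᵧ j`.
    absorb : ∀ i j → Bare i → (∀ {a b} → Wᵧ j a → Adj H a b → Wᵧ i b → Wᵧ j b) → ∀ v → Wᵧ i v → Wᵧ j v
    absorb i j bare closed v v∈ with Wᵧ? j v
    ... | yes v∈j = v∈j
    ... | no v∉j  = contradiction (λ u u∈i u∈j → v∉j (walk-closed closed (Wᵧ-connected i bare u∈i v∈) u∈j)) (meet i j)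

    -- Otherwise Wᵧ i = Wᵧ j would be a component of H, and every y l with l bare would lie outside it.
    bare∈Wᵧ : ∀ {i j} → Bare i → Bare j → i ≢ j → Wᵧ i (y j)
    bare∈Wᵧ {i} {j} bare-i bare-j i≢j with Wᵧ? i (y j)
    ... | yes y∈ = y∈
    ... | no yj∉ = contradiction many-bare (<⇒≱ (≤-trans (s≤s
            (disjoint-from-arcᵧ i (λ eq → Bare.injective (y-inj eq)) λ s → outside (Bare.sound s))) (n≤1+n _)))
      where
      i⊂j : ∀ v → Wᵧ i v → Wᵧ j v
      -- Edges leave `Wᵧ j` only towards `y j`, which is not in `Wᵧ i`.
      i⊂j = absorb i j bare-i λ a∈ ab b∈ → Wᵧ-closed j a∈ ab λ { refl → yj∉ b∈ }
      yi∉ : ¬ Wᵧ j (y i)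
      yi∉ = equal-size i j i⊂j
      j⊂i : ∀ v → Wᵧ j v → Wᵧ i v
      j⊂i = absorb j i bare-j λ a∈ ab b∈ → Wᵧ-closed i a∈ ab λ { refl → yi∉ b∈ }
      -- An edge leaving `Wᵧ i` would lead to `y i`; starting in `Wᵧ j` as well, it would put `y i`
      -- into `Wᵧ j`.
      closed : ∀ {a b} → Wᵧ i a → Adj H a b → Wᵧ i b
      closed {a} {b} a∈ ab with b ≟ y i
      ... | yes refl = contradiction (Wᵧ-closed j (i⊂j _ a∈) ab (i≢j ∘ y-inj)) yi∉
      ... | no b≢    = Wᵧ-closed i a∈ ab b≢
      outside : ∀ {l} → Bare l → ¬ Wᵧ i (y l)
      outside {l} bare-l = equal-size l i (absorb l i bare-l λ a∈ ab _ → closed a∈ ab)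

    Leaf : Fin m → Set
    Leaf i = ∃[ v ] ¬ Branching H v × Walk H (λ u → ¬ Wᵧ i u) (y i) v

    -- Each step lengthens a walk without repetitions, so a non-branching vertex is reached.
    grow : ∀ i fuel {v p q} → n < fuel + length (v ∷ p ∷ q) → Reduced H (v ∷ p ∷ q) → y i ∈ p ∷ q →
      ¬ Wᵧ i v → Walk H (λ u → ¬ Wᵧ i u) (y i) v → Leaf i
    grow i zero {v} {p} {q} long red _ _ _ = contradiction
      (injective⇒≤ (Unique-lookup-injective (H-acyclic (v ∷ p ∷ q) red (All.universal (λ _ → tt) _)))) (<⇒≱ long)
    grow i (suc fuel) {v} {p} {q} long red y∈ v∉ walk = branch (Branching? H v)
      where
      v≢y : v ≢ y i
      v≢y = Unique-head (H-acyclic (v ∷ p ∷ q) red (All.universal (λ _ → tt) _)) y∈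
      onward : ∀ w → Adj H v w → w ≢ p → Leaf i
      onward w vw w≢p = grow i fuel {w} {v} {p ∷ q} (subst (n <_) (≡-sym (+-suc fuel (length (v ∷ p ∷ q)))) long)
          (step (Adj-sym H vw) [ w≢p ] red) (there y∈) w∉ (walk-trans walk (v∉ ∷⟨ vw ⟩ [ w∉ ]))
        where
        -- The set `Wᵧ i` can be entered only from `y i`, which the walk has already left behind for
        -- good.
        w∉ : ¬ Wᵧ i w
        w∉ w∈ = v∉ (Wᵧ-closed i w∈ (Adj-sym H vw) v≢y)
      branch : Dec (Branching H v) → Leaf i
      branch (no leaf) = v , leaf , walk
      branch (yes branching) = let (w , vw , w≢p) = other-neighbour H {v} branching p in onward w vw w≢p

    -- A path from `a` to `b` inside `Wᵧ i`, preceded by `y i`, and the single edge from `y i` to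
    -- `b` are reduced walks with the same ends in the forest H.
    one-attachment : ∀ i → Bare i → ∀ {a b} → Adj H (y i) a → Adj H (y i) b → Wᵧ i a → Wᵧ i b → a ≡ b
    one-attachment i bare {a} {b} ya yb a∈ b∈ = compare (walk-reduced (Wᵧ-connected i bare a∈ b∈))
      where
      y-head : ∀ p → All (Wᵧ i) p → HeadNot (y i) p
      y-head []      _        = []
      y-head (w ∷ _) (w∈ ∷ _) = [ (λ y≡w → y∉Wᵧ i (subst (Wᵧ i) (≡-sym y≡w) w∈)) ]
      compare : (∃[ p ] Reduced H (a ∷ p) × All (Wᵧ i) (a ∷ p) × end a p ≡ b) → a ≡ b
      compare (p , red , _ ∷ p∈ , p-end) = ∷-injectiveˡ (reduced-unique H H-acyclic (y i) (a ∷ p) (b ∷ [])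
        (step ya (y-head p p∈) red) (step yb [] [-]) (All.universal (λ _ → tt) _) (All.universal (λ _ → tt) _) p-end)

    -- If `y i` branches, one of two neighbours lies outside `Wᵧ i`, and a walk is grown in that
    -- direction.
    leaf : ∀ i → Bare i → Leaf i
    leaf i bare with Branching? H (y i)
    ... | no y-leaf = y i , y-leaf , [ y∉Wᵧ i ]
    ... | yes (a , b , ya , yb , a≢b) with Wᵧ? i a | Wᵧ? i b
    ...   | yes a∈ | yes b∈ = contradiction (one-attachment i bare ya yb a∈ b∈) a≢b
    ...   | no a∉ | _ = grow i n (m<m+n n z<s) (step (Adj-sym H ya) [] [-]) (here refl) a∉ (y∉Wᵧ i ∷⟨ ya ⟩ [ a∉ ])
    ...   | yes _ | no b∉ = grow i n (m<m+n n z<s) (step (Adj-sym H yb) [] [-]) (here refl) b∉ (y∉Wᵧ i ∷⟨ yb ⟩ [ b∉ ])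

    bareLeaf : Fin Bare.size → V
    bareLeaf s = proj₁ (leaf (Bare.element s) (Bare.sound s))

    bareLeaf-leaf : ∀ s → ¬ Branching H (bareLeaf s)
    bareLeaf-leaf s = proj₁ (proj₂ (leaf (Bare.element s) (Bare.sound s)))

    -- The walk to the leaf of `j` starts at `y j`, in `Wᵧ i`. It avoids `Wᵧ j`, hence also `y i`,
    -- so it never leaves `Wᵧ i`; the leaf of `i` lies outside `Wᵧ i`.
    bareLeaf-injective : Inj bareLeaf
    bareLeaf-injective {s} {t} eq with Bare.element s ≟ Bare.element t
    ... | yes e = Bare.injective e
    ... | no i≢j = contradiction
      (walk-closed {P = Wᵧ i} (λ a∈ ab b∉ → Wᵧ-closed i a∈ ab λ { refl → b∉ (bare∈Wᵧ (Bare.sound t) (Bare.sound s) (≢-sym i≢j)) })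
        (proj₂ (proj₂ (leaf j (Bare.sound t)))) (bare∈Wᵧ (Bare.sound s) (Bare.sound t) i≢j))
      (subst (λ v → ¬ Wᵧ i v) eq (walk-end (proj₂ (proj₂ (leaf i (Bare.sound s))))))
      where
      i = Bare.element s
      j = Bare.element t

    -- A branching `y i` differs from the at least 3 + κ leaves found above. Together these are more
    -- vertices than `non-branching-bound` allows.
    y-leaf : ∀ i → ¬ Branching H (y i)
    y-leaf i br = <⇒≱ (s≤s many-bare) (non-branching-bound i
      (◂-injective bareLeaf-injective λ s eq → bareLeaf-leaf s (subst (Branching H) (≡-sym eq) br))
      λ { zero → inj₂ refl ; (suc s) → inj₁ (bareLeaf-leaf s) })

    bareIndex : Fin 3 → Fin m
    bareIndex t = Bare.element (inject≤ t (≤-trans (m≤m+n 3 κ) many-bare))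

    bareIndex-≢ : ∀ {s t} → s ≢ t → bareIndex s ≢ bareIndex t
    bareIndex-≢ s≢t eq = s≢t (inject≤-injective _ _ _ _ (Bare.injective eq))

    bareIndex-bare : ∀ t → Bare (bareIndex t)
    bareIndex-bare t = Bare.sound _

    -- Now all `y i` count in `non-branching-bound`, so 3 + 2κ ≤ m ≤ 3 + κ. This forces κ = 0 and m
    -- ≤ 3, and the hypothesis on `m` does the rest.
    n≤m : n ≤ m
    n≤m = *-cancelˡ-≤ 2 (+-cancelʳ-≤ 3 (2 * n) (2 * m) (begin
      2 * n + 3 ≤⟨ 2n+3≤3m ⟩
      3 * m     ≡⟨ +-comm m (2 * m) ⟩
      2 * m + m ≤⟨ +-monoʳ-≤ (2 * m) m≤3 ⟩
      2 * m + 3 ∎))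
      where
      open ≤-Reasoning
      m≤3+κ : m ≤ 3 + κ
      m≤3+κ = non-branching-bound (bareIndex zero) y-inj (λ s → inj₁ (y-leaf s))
      κ≤0 : κ ≤ 0
      κ≤0 = +-cancelˡ-≤ κ κ 0 (subst (κ + κ ≤_) (≡-sym (+-identityʳ κ)) (+-cancelˡ-≤ 3 _ _ (≤-trans 3+2κ≤m m≤3+κ)))
      m≤3 : m ≤ 3
      m≤3 = ≤-trans m≤3+κ (+-monoʳ-≤ 3 κ≤0)

    H-matching : ∀ v → ¬ Branching H v
    H-matching v br = <⇒≱ (s≤s n≤m) (injective⇒≤ {f = v ◂ y}
      (◂-injective y-inj λ s eq → y-leaf s (subst (Branching H) (≡-sym eq) br)))

    one-neighbour : ∀ {v a b} → Adj H v a → Adj H v b → a ≡ b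
    one-neighbour {v} {a} {b} va vb with a ≟ b
    ... | yes eq = eq
    ... | no a≢b = contradiction (a , b , va , vb , a≢b) (H-matching v)

    -- The neighbour of y j is y l because of Wᵧ i, but it lies in Wᵧ l.
    absurd : ⊥
    absurd = meets-l (walk-departs (connected l i (λ ()) (λ ())) (yj≢ {i} (λ ())))
      where
      i j l : Fin 3
      i = zero
      j = suc zero
      l = suc (suc zero)
      y′ : Fin 3 → V
      y′ t = y (bareIndex t)
      yj≢ : ∀ {t} → j ≢ t → y′ j ≢ y′ t
      yj≢ j≢t eq = bareIndex-≢ j≢t (y-inj eq)
      connected : ∀ s t → s ≢ j → s ≢ t → Walk H (Wᵧ (bareIndex s)) (y′ j) (y′ t)
      connected s t s≢j s≢t = Wᵧ-connected _ (bareIndex-bare s)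
        (bare∈Wᵧ (bareIndex-bare s) (bareIndex-bare j) (bareIndex-≢ s≢j))
        (bare∈Wᵧ (bareIndex-bare s) (bareIndex-bare t) (bareIndex-≢ s≢t))
      meets-l : ¬ (∃[ w ] Adj H (y′ j) w × Wᵧ (bareIndex l) w)
      meets-l (w , jw , w∈) = conclude (walk-closed {P = Edge} edge (connected i l (λ ()) (λ ())) (inj₁ refl))
        where
        -- As H has maximum degree one, `y′ j` and its neighbour `w` form a whole component.
        Edge : V → Set
        Edge v = v ≡ y′ j ⊎ v ≡ w
        edge : ∀ {a b} → Edge a → Adj H a b → Wᵧ (bareIndex i) b → Edge b
        edge {a} {b} (inj₁ a≡) ab _ = inj₂ (one-neighbour {y′ j} {b} {w} (subst (λ t → Adj H t b) a≡ ab) jw)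
        edge {a} {b} (inj₂ a≡) ab _ = inj₁ (one-neighbour {w} {b} {y′ j} (subst (λ t → Adj H t b) a≡ ab) (Adj-sym H jw))
        conclude : ¬ Edge (y′ l)
        conclude (inj₁ yl≡yj) = yj≢ {l} (λ ()) (≡-sym yl≡yj)
        conclude (inj₂ yl≡w)  = y∉Wᵧ (bareIndex l) (subst (Wᵧ (bareIndex l)) (≡-sym yl≡w) w∈)

  contradictory : ⊥
  contradictory = ¬¬-decidable W absurd

-- Decidability of cycles, and equality of girths.

any-vec? : ∀ {k} {P : Vec (Fin n) k → Set} → Decidable P → Dec (∃ P)
any-vec? {k = zero}  P? = map′ ([] ,_) (λ { ([] , p) → p }) (P? [])
any-vec? {k = suc k} P? = map′ (λ (i , v , p) → i ∷ v , p) (λ { (i ∷ v , p) → i , v , p })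
  (any? λ i → any-vec? λ v → P? (i ∷ v))

IsCycle? : (X : Graph n) (k : ℕ) → Decidable (IsCycle X k)
IsCycle? X k c =
  map′ (λ inj {i} {j} → inj i j) (λ inj i j → inj) (all? λ i → all? λ j → (c i ≟ c j) →-dec (i ≟ j))
  ×-dec all? (λ i → Adj? X (c (inject₁ i)) (c (suc i)))
  ×-dec Adj? X (c (fromℕ k)) (c zero)

IsCycle-≗ : (X : Graph n) {k : ℕ} {c d : Fin (suc k) → Fin n} → (∀ i → c i ≡ d i) → IsCycle X k c → IsCycle X k d
IsCycle-≗ X c≗d (inj , adjacent , last) =
    (λ {i} {j} eq → inj (trans (c≗d i) (trans eq (≡-sym (c≗d j)))))
  , (λ i → trans (≡-sym (cong₂ (adj X) (c≗d _) (c≗d _))) (adjacent i))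
  , trans (≡-sym (cong₂ (adj X) (c≗d _) (c≗d _))) last

-- Candidate cycles are searched as vectors; `IsCycle-≗` passes from a function to its tabulation.
HasCycle? : (X : Graph n) → Decidable (HasCycle X)
HasCycle? X zero    = no λ ()
HasCycle? X (suc k) = (3 ≤? suc k) ×-dec map′
  (λ (v , cyc) → Vec.lookup v , cyc)
  (λ (c , cyc) → Vec.tabulate c , IsCycle-≗ X (λ i → ≡-sym (lookup∘tabulate c i)) cyc)
  (any-vec? λ v → IsCycle? X k (Vec.lookup v))

record CommonCards (G H : Graph n) (m : ℕ) : Set where
  field
    x y         : Fin m → Fin n
    x-injective : Inj x
    y-injective : Inj y
    match       : ∀ i → CardMatch G H (x i) (y i)

module _ {m : ℕ} (2n+3≤3m : 2 * n + 3 ≤ 3 * m) where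

  -- The comparison needs a shortest cycle of G. Strong induction on `l` supplies it, since a
  -- shorter cycle of G satisfies the same hypothesis on H.
  no-longer-girth : {G H : Graph n} → CommonCards G H m →
    ∀ l → HasCycle G l → ¬ (∀ j → HasCycle H j → l < j)
  no-longer-girth {G} {H} common = <-rec _ minimise
    where
    open CommonCards common
    minimise : ∀ l → (∀ {j} → j < l → HasCycle G j → ¬ (∀ i → HasCycle H i → j < i)) →
      HasCycle G l → ¬ (∀ j → HasCycle H j → l < j)
    minimise (suc k) rec (3≤g , c , cyc) H-girth =
      Compare.contradictory G H 3≤g cyc shortest H-girth 2n+3≤3m x-injective y-injective match
      where
      shortest : ∀ j → HasCycle G j → suc k ≤ j
      shortest j hj with suc k ≤? j
      ... | yes l≤j = l≤j
      ... | no l≰j  = contradiction (λ i hi → <-trans (≰⇒> l≰j) (H-girth i hi)) (rec (≰⇒> l≰j) hj)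

  -- A cycle of H shorter than `l` would contradict `no-longer-girth` from H to G. If H had no cycle
  -- of length `l`, all its cycles would be longer, which contradicts it from G to H.
  girth-transfer : {G H : Graph n} → CommonCards G H m → CommonCards H G m → ∀ γ → IsGirth G γ → IsGirth H γ
  girth-transfer GH HG nothing none k hk =
    no-longer-girth HG k hk λ j hj → contradiction hj (none j)
  girth-transfer {G} {H} GH HG (just l) (has , least) = exists , lower
    where
    lower : ∀ k → HasCycle H k → l ≤ k
    lower k hk with l ≤? k
    ... | yes l≤k = l≤k
    ... | no l≰k  = contradiction (λ j hj → <-≤-trans (≰⇒> l≰k) (least j hj)) (no-longer-girth HG k hk)
    exists : HasCycle H l
    exists with HasCycle? H l
    ... | yes h = h
    ... | no ¬h = contradiction
      (λ j hj → ≤∧≢⇒< (lower j hj) λ l≡j → ¬h (subst (HasCycle H) (≡-sym l≡j) hj))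
      (no-longer-girth GH l has)

theorem3 : (n : ℕ) → 3 ≤ suc n → (G H : Graph (suc n)) → (m : ℕ) →
    2 * suc n + 3 ≤ 3 * m → HasCommonCards G H m → SameGirth G H
theorem3 n _ G H m bound (x , y , x-inj , y-inj , iso) γ =
  mk⇔ (girth-transfer bound GH HG γ) (girth-transfer bound HG GH γ)
  where
  match : ∀ i → CardMatch G H (x i) (y i)
  match i = card-match G H (x i) (y i) (iso i)
  GH : CommonCards G H m
  GH = record { x = x ; y = y ; x-injective = x-inj ; y-injective = y-inj ; match = match }
  HG : CommonCards H G m
  HG = record { x = y ; y = x ; x-injective = y-inj ; y-injective = x-inj ; match = λ i → match-sym (match i) }
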